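{- Let $s \geq 2$ and $n \geq k \geq 4$ be integers, and let $t = \lfloor (k-2)/2 \rfloor$. Let $G$ be a connected graph on $n$ vertices that contains no path on $k$ vertices. Then \[N_s(G) \leq \max\{f_s(n, k-1, 1),\ f_s(n, k-1, t)\},\] where $f_s(n,k',a) = \binom{k'-a}{s} + (n-k'+a)\binom{a}{s-1}$.
   Context: For an integer $s \geq 2$ and a graph $G$, $N_s(G)$ denotes the number of (unlabeled) copies of the complete graph $K_s$ in $G$, i.e., the number of $s$-element vertex subsets of $G$ that induce a clique. For integers $n,k',a$, $f_s(n,k',a) := \binom{k'-a}{s} + (n-k'+a)\binom{a}{s-1}$. A path on $k$ vertices is a (not necessarily induced) subgraph isomorphic to $P_k$. -}

module Defs where

open import Data.Nat using (ℕ; zero; suc; _+_; _*_; _∸_; _≤_)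
open import Data.Nat.Combinatorics using (_C_)
open import Data.Fin using (Fin; zero; suc; toℕ; inject₁)
open import Data.Fin.Subset using (Subset; _∈_; ∣_∣; inside; outside)
open import Data.Fin.Subset.Properties using (_∈?_)
open import Data.Fin.Properties using (all?)
open import Data.List using (List; []; _∷_; map; _++_; length; filter)
open import Data.Vec using (_∷_; [])
open import Data.Product using (Σ; _×_; _,_)
open import Relation.Nullary using (¬_; Dec; yes; no)
open import Relation.Nullary.Decidable using (_×-dec_; _→-dec_; ¬?)
open import Relation.Binary using (Decidable)
open import Relation.Binary.PropositionalEquality using (_≡_)
open import Function.Definitions using (Injective)
open import Level using (0ℓ)

record Graph (n : ℕ) : Set₁ where
  field
    Adj     : Fin n → Fin n → Set
    adj?    : Decidable Adj
    sym     : ∀ {u v} → Adj u v → Adj v u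
    irrefl  : ∀ {u} → ¬ Adj u u
open Graph public

IsClique : ∀ {n} → Graph n → Subset n → Set
IsClique G S = ∀ u v → u ∈ S → v ∈ S → ¬ (u ≡ v) → Adj G u v

isClique? : ∀ {n} (G : Graph n) (S : Subset n) → Dec (IsClique G S)
isClique? G S =
  all? λ u → all? λ v →
    (u ∈? S) →-dec ((v ∈? S) →-dec ((¬? (u Data.Fin.≟ v)) →-dec adj? G u v))

allSubsets : (n : ℕ) → List (Subset n)
allSubsets zero = [] ∷ []
allSubsets (suc n) = map (outside ∷_) (allSubsets n) ++ map (inside ∷_) (allSubsets n)

cliqueCount : ∀ {n} → ℕ → Graph n → ℕ
cliqueCount {n} s G =
  length (filter (λ S → (∣ S ∣ Data.Nat.≟ s) ×-dec isClique? G S) (allSubsets n))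

data Walk {n} (G : Graph n) : Fin n → Fin n → Set where
  here : ∀ {u} → Walk G u u
  step : ∀ {u v w} → Adj G u v → Walk G v w → Walk G u w

Connected : ∀ {n} → Graph n → Set
Connected G = ∀ u v → Walk G u v

ContainsPath : ∀ {n} → Graph n → ℕ → Set
ContainsPath {n} G k =
  Σ (Fin k → Fin n) λ p →
    Injective _≡_ _≡_ p ×
    (∀ (i : Fin k) (j : Fin k) → suc (toℕ i) ≡ toℕ j → Adj G (p i) (p j))

f : ℕ → ℕ → ℕ → ℕ → ℕ
f s n k' a = ((k' ∸ a) C s) + ((n ∸ k') + a) * (a C (s ∸ 1))

{-# OPTIONS --safe #-}
-- Kopylov's disintegration, with Luo's count of cliques. Adding edges as long as no path on k
-- vertices appears only increases the clique count, so let G be saturated; then any two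
-- nonadjacent vertices x, y start disjoint paths with at least k vertices in total. If x and y lie
-- in sets X, Y of minimum degrees summing to at least k - 1, a longest such pair of paths contains
-- all neighbours of x in X and of y in Y, and Pósa's crossing-chord argument (in G plus a universal
-- vertex, which glues the two paths together) produces a path on k vertices. So X and Y are fully joined.
-- Now delete vertices of degree at most t = ⌊(k-2)/2⌋. Either this never gets stuck, which gives
-- f s n (k-1) t, or the core left over is a clique K with |K| > k-1-t. Deleting vertices of degree at
-- most a = k-1-|K| either never gets stuck, giving f s n (k-1) a with 1 ≤ a ≤ t, hence the bound since
-- f is convex in a; or leaves a core that is fully joined to K, and K can be enlarged.

module Submission where

open import Defs
open import Data.Nat using (ℕ; zero; suc; pred; _+_; _*_; _∸_; _⊔_; _/_; _%_; _≤_; _<_; ≤′-refl; ≤′-step; z≤n; s≤s)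
open import Data.Nat.Properties
open import Data.Nat.DivMod using (m/n≤m; m%n<n; m≡m%n+[m/n]*n)
open import Data.Nat.Combinatorics using (_C_; nCk+nC[k+1]≡[n+1]C[k+1])
open import Data.Nat.Tactic.RingSolver using (solve-∀)
open import Data.Fin using (Fin; zero; suc; toℕ; inject≤)
import Data.Fin as Fin
open import Data.Fin.Properties using (any?; injective⇒≤; toℕ-inject≤; inject≤-injective)
open import Data.Fin.Subset using (Subset; _∈_; _∉_; _⊆_; _∪_; ⁅_⁆; ∣_∣; inside; outside; ⊤)
open import Data.Fin.Subset.Properties using (_∈?_; _⊆?_; drop-there; ∈⊤; ∣⊤∣≡n; p⊆q⇒∣p∣≤∣q∣; drop-∷-⊆; ∣⊥∣≡0; Empty-unique; nonempty?; p⊂q⇒∣p∣<∣q∣; p⊆p∪q; x∈p∪q⁺; x∈p∪q⁻; x∈⁅x⁆; x∈⁅y⁆⇒x≡y)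
open import Data.Vec using (_∷_; []; _[_]≔_; here; there; tabulate)
open import Data.Vec.Properties using (lookup∘tabulate; lookup⇒[]=; []=⇒lookup)
open import Data.List using (List; []; _∷_; [_]; map; _++_; length; filter; reverse; lookup; allFin; cartesianProduct)
import Data.List as List
open import Data.List.Properties using (length-++; length-reverse; length-map; unfold-reverse; ++-assoc; length-tabulate; map-++; ∷-injectiveʳ)
open import Data.List.Membership.Propositional using () renaming (_∈_ to _∈ₗ_; _∉_ to _∉ₗ_)
open import Data.List.Membership.Propositional.Properties using (∈-++⁺ˡ; ∈-++⁺ʳ; ∈-++⁻; ∈-∃++; ∈-map⁻; ∈-filter⁻; ∈-allFin; ∈-cartesianProduct⁺; ∉[]; ∈-lookup)
open import Data.List.Membership.DecPropositional using () renaming (_∈?_ to memberOf)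
open import Data.List.Relation.Unary.Any using (here; there)
import Data.List.Relation.Unary.Any.Properties as Any
open import Data.List.Relation.Unary.All as All using (All; []; _∷_)
import Data.List.Relation.Unary.All.Properties as All
open import Data.List.Relation.Unary.AllPairs using ([]; _∷_)
open import Data.List.Relation.Unary.Unique.Propositional using (Unique)
import Data.List.Relation.Unary.Unique.Propositional.Properties as Unique
open import Data.List.Relation.Binary.Disjoint.Propositional using (Disjoint)
open import Data.Maybe using (Maybe; just; nothing)
import Data.Maybe.Properties as Maybe
open import Data.Product using (∃; ∃₂; _×_; _,_; proj₁; proj₂)
open import Data.Sum using (_⊎_; inj₁; inj₂)
open import Data.Empty using (⊥; ⊥-elim)
open import Data.Unit using (tt) renaming (⊤ to Unit)
open import Function using (_∘_)
open import Function.Definitions using (Injective)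
open import Relation.Nullary using (¬_; Dec; yes; no; does; contradiction)
open import Relation.Nullary.Decidable using (_×-dec_; dec-true; decidable-stable; _⊎-dec_; ¬?)
open import Relation.Unary using (Decidable)
open import Relation.Binary.PropositionalEquality using (_≡_; _≢_; refl; cong; cong₂; subst; module ≡-Reasoning) renaming (sym to ≡-sym; trans to ≡-trans)

private variable
  A B : Set

-- Counting

⟦_⟧ : Dec A → ℕ
⟦ yes _ ⟧ = 1
⟦ no _ ⟧  = 0

⟦⟧-yes : (d : Dec A) → A → ⟦ d ⟧ ≡ 1
⟦⟧-yes (yes _) _ = refl
⟦⟧-yes (no ¬a) a = contradiction a ¬a

⟦⟧-no : (d : Dec A) → ¬ A → ⟦ d ⟧ ≡ 0
⟦⟧-no (yes a) ¬a = contradiction a ¬a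
⟦⟧-no (no _)  _  = refl

⟦⟧≤1 : (d : Dec A) → ⟦ d ⟧ ≤ 1
⟦⟧≤1 (yes _) = ≤-refl
⟦⟧≤1 (no _)  = z≤n

module _ {A : Set} where

  private variable
    P Q R : A → Set

  # : Decidable P → List A → ℕ
  # P? []       = 0
  # P? (x ∷ xs) = ⟦ P? x ⟧ + # P? xs

  #-filter : (P? : Decidable P) → ∀ xs → length (filter P? xs) ≡ # P? xs
  #-filter P? []       = refl
  #-filter P? (x ∷ xs) with P? x
  ... | yes _ = cong suc (#-filter P? xs)
  ... | no _  = #-filter P? xs

  #-++ : (P? : Decidable P) → ∀ xs ys → # P? (xs ++ ys) ≡ # P? xs + # P? ys
  #-++ P? []       ys = refl
  #-++ P? (x ∷ xs) ys = ≡-trans (cong (⟦ P? x ⟧ +_) (#-++ P? xs ys)) (≡-sym (+-assoc ⟦ P? x ⟧ _ _))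

  #-none : (P? : Decidable P) → ∀ xs → (∀ {x} → x ∈ₗ xs → ¬ P x) → # P? xs ≡ 0
  #-none P? []       none = refl
  #-none P? (x ∷ xs) none = cong₂ _+_ (⟦⟧-no (P? x) (none (here refl))) (#-none P? xs (none ∘ there))

  #-≤-length : (P? : Decidable P) → ∀ xs → # P? xs ≤ length xs
  #-≤-length P? []       = z≤n
  #-≤-length P? (x ∷ xs) = +-mono-≤ (⟦⟧≤1 (P? x)) (#-≤-length P? xs)

  #-mono : (P? : Decidable P) (Q? : Decidable Q) → (∀ {x} → P x → Q x) → ∀ xs → # P? xs ≤ # Q? xs
  #-mono P? Q? P⊆Q []       = z≤n
  #-mono P? Q? P⊆Q (x ∷ xs) = +-mono-≤ (pointwise (P? x) (Q? x)) (#-mono P? Q? P⊆Q xs)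
    where
    pointwise : ∀ p q → ⟦ p ⟧ ≤ ⟦ q ⟧
    pointwise (no _)  _       = z≤n
    pointwise (yes _) (yes _) = ≤-refl
    pointwise (yes p) (no ¬q) = contradiction (P⊆Q p) ¬q

  #-cover : (P? : Decidable P) (Q? : Decidable Q) (R? : Decidable R) →
            (∀ {x} → P x → Q x ⊎ R x) → ∀ xs → # P? xs ≤ # Q? xs + # R? xs
  #-cover P? Q? R? cover []       = z≤n
  #-cover P? Q? R? cover (x ∷ xs) = begin
    ⟦ P? x ⟧ + # P? xs                            ≤⟨ +-mono-≤ (pointwise (P? x) (Q? x) (R? x)) (#-cover P? Q? R? cover xs) ⟩
    (⟦ Q? x ⟧ + ⟦ R? x ⟧) + (# Q? xs + # R? xs)   ≡⟨ interchange ⟦ Q? x ⟧ ⟦ R? x ⟧ _ _ ⟩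
    (⟦ Q? x ⟧ + # Q? xs) + (⟦ R? x ⟧ + # R? xs)   ∎
    where
    open ≤-Reasoning
    interchange : ∀ a b c d → (a + b) + (c + d) ≡ (a + c) + (b + d)
    interchange = solve-∀
    pointwise : ∀ p q r → ⟦ p ⟧ ≤ ⟦ q ⟧ + ⟦ r ⟧
    pointwise (no _)  _       _       = z≤n
    pointwise (yes _) (yes _) _       = s≤s z≤n
    pointwise (yes _) (no _)  (yes _) = ≤-refl
    pointwise (yes p) (no ¬q) (no ¬r) with cover p
    ... | inj₁ q = contradiction q ¬q
    ... | inj₂ r = contradiction r ¬r

#-map : (g : A → B) {P : B → Set} (P? : Decidable P) → ∀ xs → # P? (map g xs) ≡ # (P? ∘ g) xs
#-map g P? []       = refl
#-map g P? (x ∷ xs) = cong (_ +_) (#-map g P? xs)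

-- Binomial coefficients

nC0≡1 : ∀ n → n C 0 ≡ 1
nC0≡1 zero    = refl
nC0≡1 (suc n) = refl

C-suc : ∀ m j → m C j ≤ suc m C j
C-suc m zero    = ≤-reflexive (≡-trans (nC0≡1 m) (≡-sym (nC0≡1 (suc m))))
C-suc m (suc j) = ≤-trans (m≤n+m _ (m C j)) (≤-reflexive (nCk+nC[k+1]≡[n+1]C[k+1] m j))

C-monoˡ : ∀ {m n} j → m ≤ n → m C j ≤ n C j
C-monoˡ j m≤n with ≤⇒≤′ m≤n
... | ≤′-refl = ≤-refl
... | ≤′-step m≤′n = ≤-trans (C-monoˡ j (≤′⇒≤ m≤′n)) (C-suc _ j)

-- Nonnegative second differences, written additively because subtraction on `ℕ` truncates.
Convex : (ℕ → ℕ) → Set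
Convex h = ∀ a → h (1 + a) + h (1 + a) ≤ h a + h (2 + a)

-- By Pascal's rule the increment of `_C suc j` at `m` is `m C j`, which increases with `m`.
C-convex : ∀ s → Convex (_C s)
C-convex zero    m = ≤-reflexive (≡-sym (cong₂ _+_ (nC0≡1 m) refl))
C-convex (suc j) m = begin
  X + X                                    ≡⟨ cong (_+ X) (nCk+nC[k+1]≡[n+1]C[k+1] m j) ⟨
  (m C j + m C suc j) + X                  ≤⟨ +-monoˡ-≤ X (+-monoˡ-≤ (m C suc j) (C-suc m j)) ⟩
  (suc m C j + m C suc j) + X              ≡⟨ rearrange (suc m C j) (m C suc j) X ⟩
  m C suc j + (suc m C j + X)              ≡⟨ cong (m C suc j +_) (nCk+nC[k+1]≡[n+1]C[k+1] (suc m) j) ⟩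
  m C suc j + suc (suc m) C suc j          ∎
  where
  open ≤-Reasoning
  X = suc m C suc j
  rearrange : ∀ a b c → (a + b) + c ≡ b + (a + c)
  rearrange = solve-∀

-- Reflection keeps convexity; the only delicate place is where `k ∸ a` reaches zero and stays
-- there, and monotonicity of binomials settles it.
C-reflected-convex : ∀ k s → Convex (λ a → (k ∸ a) C s)
C-reflected-convex k s a
  rewrite ≡-sym (pred[m∸n]≡m∸[1+n] k (suc a)) | ≡-sym (pred[m∸n]≡m∸[1+n] k a) = at (k ∸ a)
  where
  at : ∀ m → pred m C s + pred m C s ≤ m C s + pred (pred m) C s
  at zero          = ≤-refl
  at (suc zero)    = +-monoˡ-≤ _ (C-suc 0 s)
  at (suc (suc m)) = ≤-trans (C-convex s m) (≤-reflexive (+-comm (m C s) _))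

-- With `e = c + a`, the doubled middle term is `2b₁ + e(2b₁)`: monotonicity turns the first summand
-- into `2b₂`, convexity of `b` the second into `e(b₀ + b₂)`.
affine*-convex : ∀ c (b : ℕ → ℕ) → (∀ a → b a ≤ b (suc a)) → Convex b → Convex (λ a → (c + a) * b a)
affine*-convex c b b-mono b-convex a rewrite +-suc c (suc a) | +-suc c a = begin
  (b₁ + e * b₁) + (b₁ + e * b₁)    ≡⟨ rearrange b₁ e ⟩
  (b₁ + b₁) + e * (b₁ + b₁)        ≤⟨ +-mono-≤ (+-mono-≤ (b-mono (suc a)) (b-mono (suc a))) (*-monoʳ-≤ e (b-convex a)) ⟩
  (b₂ + b₂) + e * (b₀ + b₂)        ≡⟨ rearrange′ b₀ b₂ e ⟩
  e * b₀ + (b₂ + (b₂ + e * b₂))    ∎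
  where
  open ≤-Reasoning
  e = c + a
  b₀ = b a
  b₁ = b (1 + a)
  b₂ = b (2 + a)
  rearrange : ∀ b e → (b + e * b) + (b + e * b) ≡ (b + b) + e * (b + b)
  rearrange = solve-∀
  rearrange′ : ∀ b₀ b₂ e → (b₂ + b₂) + e * (b₀ + b₂) ≡ e * b₀ + (b₂ + (b₂ + e * b₂))
  rearrange′ = solve-∀

+-convex : ∀ {g h} → Convex g → Convex h → Convex (λ a → g a + h a)
+-convex {g} {h} g-convex h-convex a = begin
  (g (1 + a) + h (1 + a)) + (g (1 + a) + h (1 + a))  ≡⟨ interchange (g (1 + a)) _ _ _ ⟩
  (g (1 + a) + g (1 + a)) + (h (1 + a) + h (1 + a))  ≤⟨ +-mono-≤ (g-convex a) (h-convex a) ⟩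
  (g a + g (2 + a)) + (h a + h (2 + a))              ≡⟨ interchange (g a) _ _ _ ⟩
  (g a + h a) + (g (2 + a) + h (2 + a))              ∎
  where
  open ≤-Reasoning
  interchange : ∀ a b c d → (a + b) + (c + d) ≡ (a + c) + (b + d)
  interchange = solve-∀

f-convex : ∀ s n k → Convex (f s n k)
f-convex s n k = +-convex {λ a → (k ∸ a) C s} {λ a → (n ∸ k + a) * (a C (s ∸ 1))} (C-reflected-convex k s)
  (affine*-convex (n ∸ k) (_C (s ∸ 1)) (λ a → C-suc a (s ∸ 1)) (C-convex (s ∸ 1)))

-- Maxima of convex sequences

module _ {h : ℕ → ℕ} (h-convex : Convex h) where

  rising : ∀ a → h a ≤ h (1 + a) → h (1 + a) ≤ h (2 + a)
  rising a up = +-cancelˡ-≤ (h (1 + a)) _ _ (≤-trans (h-convex a) (+-monoˡ-≤ _ up))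

  rising-from : ∀ a d → h a ≤ h (1 + a) → h a ≤ h (a + d)
  rising-from a zero    up = ≤-reflexive (cong h (≡-sym (+-identityʳ a)))
  rising-from a (suc d) up = ≤-trans up
    (subst (λ b → h (suc a) ≤ h b) (≡-sym (+-suc a d)) (rising-from (suc a) d (rising a up)))

  -- As long as every step goes down, the values stay at most `h 0`; after one step up, `rising`
  -- makes all later steps go up.
  falling-or-rising : ∀ a → h a ≤ h 0 ⊎ h a ≤ h (1 + a)
  falling-or-rising zero = inj₁ ≤-refl
  falling-or-rising (suc a) with h a ≤? h (1 + a) | falling-or-rising a
  ... | yes up | _         = inj₂ (rising a up)
  ... | no ¬up | inj₁ down = inj₁ (≤-trans (<⇒≤ (≰⇒> ¬up)) down)
  ... | no ¬up | inj₂ up   = contradiction up ¬up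

  convex-≤-⊔ : ∀ a d → h a ≤ h 0 ⊔ h (a + d)
  convex-≤-⊔ a d with falling-or-rising a
  ... | inj₁ down = ≤-trans down (m≤m⊔n (h 0) _)
  ... | inj₂ up   = ≤-trans (rising-from a d up) (m≤n⊔m (h 0) _)

-- Subsets

setOf : ∀ {n} {P : Fin n → Set} → Decidable P → Subset n
setOf P? = tabulate (does ∘ P?)

module _ {n} {P : Fin n → Set} (P? : Decidable P) where

  ∈-setOf⁺ : ∀ {v} → P v → v ∈ setOf P?
  ∈-setOf⁺ {v} p = lookup⇒[]= v _ (≡-trans (lookup∘tabulate (does ∘ P?) v) (dec-true (P? v) p))

  ∈-setOf⁻ : ∀ {v} → v ∈ setOf P? → P v
  ∈-setOf⁻ {v} v∈ with P? v | ≡-trans (≡-sym (lookup∘tabulate (does ∘ P?) v)) ([]=⇒lookup v∈)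
  ... | yes p | _ = p

erase : ∀ {n} → Fin n → Subset n → Subset n
erase v S = S [ v ]≔ outside

∈-erase⁻ : ∀ {n} {u v : Fin n} {S} → u ∈ erase v S → u ∈ S × u ≢ v
∈-erase⁻ {u = zero}  {zero}  {x ∷ S} ()
∈-erase⁻ {u = zero}  {suc v} {x ∷ S} here       = here , λ ()
∈-erase⁻ {u = suc u} {zero}  {x ∷ S} (there u∈) = there u∈ , λ ()
∈-erase⁻ {u = suc u} {suc v} {x ∷ S} (there u∈) with ∈-erase⁻ u∈
... | u∈S , u≢v = there u∈S , λ { refl → u≢v refl }

∈-erase⁺ : ∀ {n} {u v : Fin n} {S} → u ∈ S → u ≢ v → u ∈ erase v S
∈-erase⁺ {u = zero}  {zero}  here       u≢v = contradiction refl u≢v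
∈-erase⁺ {u = zero}  {suc v} here       u≢v = here
∈-erase⁺ {u = suc u} {zero}  (there u∈) u≢v = there u∈
∈-erase⁺ {u = suc u} {suc v} (there u∈) u≢v = there (∈-erase⁺ u∈ λ { refl → u≢v refl })

∣erase∣ : ∀ {n} {v : Fin n} {S} → v ∈ S → ∣ S ∣ ≡ suc ∣ erase v S ∣
∣erase∣ here                          = refl
∣erase∣ {S = inside ∷ S}  (there v∈S) = cong suc (∣erase∣ v∈S)
∣erase∣ {S = outside ∷ S} (there v∈S) = ∣erase∣ v∈S

card-≤-# : ∀ {n} (N : Subset n) (xs : List (Fin n)) → (∀ {v} → v ∈ N → v ∈ₗ xs) → ∣ N ∣ ≤ # (_∈? N) xs
card-≤-# {n} N [] N⊆ = subst (λ M → ∣ M ∣ ≤ 0) (≡-sym N≡⊥) (≤-reflexive (∣⊥∣≡0 n))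
  where
  N≡⊥ = Empty-unique λ (v , v∈N) → ∉[] (N⊆ v∈N)
card-≤-# N (x ∷ xs) N⊆ with x ∈? N
... | yes x∈N = ≤-trans (≤-reflexive (∣erase∣ x∈N)) (s≤s (≤-trans
        (card-≤-# (erase x N) xs λ v∈ → tail⁻ (∈-erase⁻ v∈ .proj₂) (N⊆ (∈-erase⁻ v∈ .proj₁)))
        (#-mono (_∈? erase x N) (_∈? N) (proj₁ ∘ ∈-erase⁻) xs)))
  where
  tail⁻ : ∀ {v} → v ≢ x → v ∈ₗ (x ∷ xs) → v ∈ₗ xs
  tail⁻ v≢x (here v≡x)  = contradiction v≡x v≢x
  tail⁻ v≢x (there v∈)  = v∈
... | no x∉N = card-≤-# N xs λ v∈ → tail⁻ v∈ (N⊆ v∈)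
  where
  tail⁻ : ∀ {v} → v ∈ N → v ∈ₗ (x ∷ xs) → v ∈ₗ xs
  tail⁻ v∈N (here refl) = contradiction v∈N x∉N
  tail⁻ v∈N (there v∈)  = v∈

#-allSubsets : ∀ {n} {P : Subset (suc n) → Set} (P? : Decidable P) →
               # P? (allSubsets (suc n)) ≡ # (P? ∘ (outside ∷_)) (allSubsets n) + # (P? ∘ (inside ∷_)) (allSubsets n)
#-allSubsets {n} P? = ≡-trans (#-++ P? (map (outside ∷_) (allSubsets n)) _)
  (cong₂ _+_ (#-map (outside ∷_) P? (allSubsets n)) (#-map (inside ∷_) P? (allSubsets n)))

-- Erasing v is injective on the sets containing v.
#-erase : ∀ {n} (v : Fin n) {P Q : Subset n → Set} (P? : Decidable P) (Q? : Decidable Q) →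
          (∀ {S} → P S → v ∈ S × Q (erase v S)) → # P? (allSubsets n) ≤ # Q? (allSubsets n)
#-erase {suc n} zero P? Q? P⇒ = begin
  # P? (allSubsets (suc n))                   ≡⟨ #-allSubsets P? ⟩
  # (P? ∘ (outside ∷_)) (allSubsets n) + # (P? ∘ (inside ∷_)) (allSubsets n)
    ≡⟨ cong (_+ # (P? ∘ (inside ∷_)) (allSubsets n)) (#-none (P? ∘ (outside ∷_)) (allSubsets n) λ _ → 0∉outside ∘ proj₁ ∘ P⇒) ⟩
  # (P? ∘ (inside ∷_)) (allSubsets n)         ≤⟨ #-mono (P? ∘ (inside ∷_)) (Q? ∘ (outside ∷_)) (proj₂ ∘ P⇒) (allSubsets n) ⟩
  # (Q? ∘ (outside ∷_)) (allSubsets n)        ≤⟨ m≤m+n _ _ ⟩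
  # (Q? ∘ (outside ∷_)) (allSubsets n) + # (Q? ∘ (inside ∷_)) (allSubsets n)  ≡⟨ #-allSubsets Q? ⟨
  # Q? (allSubsets (suc n))                   ∎
  where
  open ≤-Reasoning
  0∉outside : ∀ {S : Subset n} → zero ∉ outside ∷ S
  0∉outside ()
#-erase {suc n} (suc v) P? Q? P⇒ = begin
  # P? (allSubsets (suc n))                   ≡⟨ #-allSubsets P? ⟩
  # (P? ∘ (outside ∷_)) (allSubsets n) + # (P? ∘ (inside ∷_)) (allSubsets n)
    ≤⟨ +-mono-≤ (#-erase v (P? ∘ (outside ∷_)) (Q? ∘ (outside ∷_)) λ p → drop-there (P⇒ p .proj₁) , P⇒ p .proj₂)
                (#-erase v (P? ∘ (inside ∷_)) (Q? ∘ (inside ∷_)) λ p → drop-there (P⇒ p .proj₁) , P⇒ p .proj₂) ⟩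
  # (Q? ∘ (outside ∷_)) (allSubsets n) + # (Q? ∘ (inside ∷_)) (allSubsets n)  ≡⟨ #-allSubsets Q? ⟨
  # Q? (allSubsets (suc n))                   ∎
  where open ≤-Reasoning

subsetOfSize? : ∀ {n} j (N : Subset n) → Decidable (λ T → ∣ T ∣ ≡ j × T ⊆ N)
subsetOfSize? j N T = (∣ T ∣ ≟ j) ×-dec (T ⊆? N)

#-subsetsOfSize : ∀ {n} j (N : Subset n) → # (subsetOfSize? j N) (allSubsets n) ≤ ∣ N ∣ C j
#-subsetsOfSize zero    [] = #-≤-length (subsetOfSize? 0 []) ([] ∷ [])
#-subsetsOfSize (suc j) [] = ≤-reflexive (#-none (subsetOfSize? (suc j) []) (allSubsets 0) λ { {[]} _ (() , _) })
#-subsetsOfSize {suc n} j (outside ∷ N) = begin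
  # N?₊ (allSubsets (suc n))                      ≡⟨ #-allSubsets N?₊ ⟩
  # (N?₊ ∘ (outside ∷_)) (allSubsets n) + # (N?₊ ∘ (inside ∷_)) (allSubsets n)
    ≤⟨ +-mono-≤ (#-mono (N?₊ ∘ (outside ∷_)) (subsetOfSize? j N) (λ (c , T⊆) → c , drop-∷-⊆ T⊆) (allSubsets n))
                (≤-reflexive (#-none (N?₊ ∘ (inside ∷_)) (allSubsets n) λ _ (_ , T⊆) → 0∉outside (T⊆ here))) ⟩
  # (subsetOfSize? j N) (allSubsets n) + 0        ≡⟨ +-identityʳ _ ⟩
  # (subsetOfSize? j N) (allSubsets n)            ≤⟨ #-subsetsOfSize j N ⟩
  ∣ N ∣ C j                                        ∎
  where
  open ≤-Reasoning
  N?₊ = subsetOfSize? j (outside ∷ N)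
  0∉outside : ∀ {S : Subset n} → zero ∉ outside ∷ S
  0∉outside ()
#-subsetsOfSize {suc n} zero (inside ∷ N) = begin
  # N?₊ (allSubsets (suc n))                      ≡⟨ #-allSubsets N?₊ ⟩
  # (N?₊ ∘ (outside ∷_)) (allSubsets n) + # (N?₊ ∘ (inside ∷_)) (allSubsets n)
    ≤⟨ +-mono-≤ (#-mono (N?₊ ∘ (outside ∷_)) (subsetOfSize? 0 N) (λ (c , T⊆) → c , drop-∷-⊆ T⊆) (allSubsets n))
                (≤-reflexive (#-none (N?₊ ∘ (inside ∷_)) (allSubsets n) λ { _ (() , _) })) ⟩
  # (subsetOfSize? 0 N) (allSubsets n) + 0        ≡⟨ +-identityʳ _ ⟩
  # (subsetOfSize? 0 N) (allSubsets n)            ≤⟨ #-subsetsOfSize 0 N ⟩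
  ∣ N ∣ C 0                                        ≤⟨ C-suc ∣ N ∣ 0 ⟩
  suc ∣ N ∣ C 0                                    ∎
  where
  open ≤-Reasoning
  N?₊ = subsetOfSize? 0 (inside ∷ N)
#-subsetsOfSize {suc n} (suc j) (inside ∷ N) = begin
  # N?₊ (allSubsets (suc n))                      ≡⟨ #-allSubsets N?₊ ⟩
  # (N?₊ ∘ (outside ∷_)) (allSubsets n) + # (N?₊ ∘ (inside ∷_)) (allSubsets n)
    ≤⟨ +-mono-≤ (#-mono (N?₊ ∘ (outside ∷_)) (subsetOfSize? (suc j) N) (λ (c , T⊆) → c , drop-∷-⊆ T⊆) (allSubsets n))
                (#-mono (N?₊ ∘ (inside ∷_)) (subsetOfSize? j N) (λ (c , T⊆) → suc-injective c , drop-∷-⊆ T⊆) (allSubsets n)) ⟩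
  # (subsetOfSize? (suc j) N) (allSubsets n) + # (subsetOfSize? j N) (allSubsets n)
    ≤⟨ +-mono-≤ (#-subsetsOfSize (suc j) N) (#-subsetsOfSize j N) ⟩
  ∣ N ∣ C suc j + ∣ N ∣ C j                        ≡⟨ +-comm (∣ N ∣ C suc j) _ ⟩
  ∣ N ∣ C j + ∣ N ∣ C suc j                        ≡⟨ nCk+nC[k+1]≡[n+1]C[k+1] ∣ N ∣ j ⟩
  suc ∣ N ∣ C suc j                                ∎
  where
  open ≤-Reasoning
  N?₊ = subsetOfSize? (suc j) (inside ∷ N)

-- Cliques inside a vertex set

module _ {n} (G : Graph n) where

  cliqueIn? : ∀ s U → Decidable (λ S → (∣ S ∣ ≡ s × S ⊆ U) × IsClique G S)
  cliqueIn? s U S = subsetOfSize? s U S ×-dec isClique? G S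

  cliquesIn : ℕ → Subset n → ℕ
  cliquesIn s U = # (cliqueIn? s U) (allSubsets n)

  nbr? : ∀ v U → Decidable (λ u → Adj G v u × u ∈ U)
  nbr? v U u = adj? G v u ×-dec (u ∈? U)

  nbrs : Fin n → Subset n → Subset n
  nbrs v U = setOf (nbr? v U)

  -- A clique of `U` through `v` is determined by its other `j` vertices, all neighbours of `v` in
  -- `U`. For an upper bound, any `j`-subset of these neighbours is counted, clique or not.
  cliquesIn-erase : ∀ j v U → cliquesIn (suc j) U ≤ cliquesIn (suc j) (erase v U) + ∣ nbrs v U ∣ C j
  cliquesIn-erase j v U = ≤-trans
    (#-cover (cliqueIn? (suc j) U) (cliqueIn? (suc j) (erase v U)) through? split (allSubsets n))
    (+-monoʳ-≤ _ (≤-trans (#-erase v through? (subsetOfSize? j (nbrs v U)) link) (#-subsetsOfSize j (nbrs v U))))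
    where
    through? : Decidable (λ S → v ∈ S × (∣ S ∣ ≡ suc j × S ⊆ U) × IsClique G S)
    through? S = (v ∈? S) ×-dec cliqueIn? (suc j) U S
    split : ∀ {S} → (∣ S ∣ ≡ suc j × S ⊆ U) × IsClique G S →
            ((∣ S ∣ ≡ suc j × S ⊆ erase v U) × IsClique G S) ⊎ (v ∈ S × (∣ S ∣ ≡ suc j × S ⊆ U) × IsClique G S)
    split {S} clique@((c , S⊆U) , q) with v ∈? S
    ... | yes v∈S = inj₂ (v∈S , clique)
    ... | no  v∉S = inj₁ ((c , λ u∈S → ∈-erase⁺ (S⊆U u∈S) λ { refl → v∉S u∈S }) , q)
    link : ∀ {S} → v ∈ S × (∣ S ∣ ≡ suc j × S ⊆ U) × IsClique G S →
           v ∈ S × ∣ erase v S ∣ ≡ j × erase v S ⊆ nbrs v U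
    link (v∈S , (c , S⊆U) , q) = v∈S , suc-injective (≡-trans (≡-sym (∣erase∣ v∈S)) c) , λ u∈ →
      let u∈S , u≢v = ∈-erase⁻ u∈ in ∈-setOf⁺ (nbr? v U) (q _ _ v∈S u∈S (u≢v ∘ ≡-sym) , S⊆U u∈S)

  -- If deleting vertices of degree at most d never gets stuck, the last r vertices carry
  -- at most C(r,s) cliques and every deletion destroyed at most C(d,s-1).
  disintegrate : ∀ j r d m U → ∣ U ∣ ≡ m + r →
                 cliquesIn (suc j) U ≤ r C suc j + m * (d C j) ⊎
                 ∃ λ X → r < ∣ X ∣ × (∀ {v} → v ∈ X → d < ∣ nbrs v X ∣)
  disintegrate j r d zero U refl = inj₁ (≤-trans
    (#-mono (cliqueIn? (suc j) U) (subsetOfSize? (suc j) U) proj₁ (allSubsets n))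
    (≤-trans (#-subsetsOfSize (suc j) U) (≤-reflexive (≡-sym (+-identityʳ _)))))
  disintegrate j r d (suc m) U ∣U∣ with any? (λ v → (v ∈? U) ×-dec (∣ nbrs v U ∣ ≤? d))
  ... | no stuck = inj₂ (U , ≤-trans (s≤s (m≤n+m r m)) (≤-reflexive (≡-sym ∣U∣)) ,
                          λ v∈U → ≰⇒> λ deg≤d → stuck (_ , v∈U , deg≤d))
  ... | yes (v , v∈U , deg≤d) with disintegrate j r d m (erase v U) (suc-injective (≡-trans (≡-sym (∣erase∣ v∈U)) ∣U∣))
  ...   | inj₂ core  = inj₂ core
  ...   | inj₁ bound = inj₁ (begin
    cliquesIn (suc j) U                               ≤⟨ cliquesIn-erase j v U ⟩
    cliquesIn (suc j) (erase v U) + ∣ nbrs v U ∣ C j  ≤⟨ +-mono-≤ bound (C-monoˡ j deg≤d) ⟩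
    (r C suc j + m * (d C j)) + d C j                 ≡⟨ rearrange (r C suc j) (m * (d C j)) (d C j) ⟩
    r C suc j + (d C j + m * (d C j))                 ∎)
    where
    open ≤-Reasoning
    rearrange : ∀ a b c → (a + b) + c ≡ a + (c + b)
    rearrange = solve-∀

-- Lists and paths

unique-++⁻ : ∀ (xs : List A) {ys} → Unique (xs ++ ys) → Unique xs × Unique ys × Disjoint xs ys
unique-++⁻ []       u        = [] , u , λ { (() , _) }
unique-++⁻ (x ∷ xs) (x≢ ∷ u) with unique-++⁻ xs u
... | uxs , uys , disjoint = All.++⁻ˡ xs x≢ ∷ uxs , uys , λ
  { (here refl , y∈) → All.lookup (All.++⁻ʳ xs x≢) y∈ refl
  ; (there x∈ , y∈)  → disjoint (x∈ , y∈) }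

unique-∷ : ∀ {x : A} {xs} → x ∉ₗ xs → Unique xs → Unique (x ∷ xs)
unique-∷ x∉ u = All.tabulate (λ y∈ → λ { refl → x∉ y∈ }) ∷ u

unique-reverse : ∀ {xs : List A} → Unique xs → Unique (reverse xs)
unique-reverse {xs = []}     u           = u
unique-reverse {xs = x ∷ xs} u₀@(_ ∷ u) = subst Unique (≡-sym (unfold-reverse x xs))
  (Unique.++⁺ (unique-reverse u) ([] ∷ []) λ { (x∈ , here refl) → Unique.Unique[x∷xs]⇒x∉xs u₀ (Any.reverse⁻ x∈) })

lookup-injective : ∀ {xs : List A} → Unique xs → Injective _≡_ _≡_ (lookup xs)
lookup-injective (_ ∷ _)  {zero}  {zero}  eq = refl
lookup-injective (x≢ ∷ _) {zero}  {suc j} eq = contradiction eq (All.lookup x≢ (∈-lookup j))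
lookup-injective (x≢ ∷ _) {suc i} {zero}  eq = contradiction (≡-sym eq) (All.lookup x≢ (∈-lookup i))
lookup-injective (_ ∷ u)  {suc i} {suc j} eq = cong suc (lookup-injective u eq)

unique⇒length≤ : ∀ {n} {xs : List (Fin n)} → Unique xs → length xs ≤ n
unique⇒length≤ u = injective⇒≤ (lookup-injective u)

infixr 5 _◅_

-- The vertex list is an index, so that distinctness is a separate `Unique` statement on plain lists
-- and `length` counts vertices, as in the definition of a path on `k` vertices.
data Path {V : Set} (E : V → V → Set) : V → List V → V → Set where
  stop : ∀ {u} → Path E u (u ∷ []) u
  _◅_  : ∀ {u v xs w} → E u v → Path E v xs w → Path E u (u ∷ xs) w

module _ {V : Set} {E : V → V → Set} where

  path-uncons : ∀ {u xs w} → Path E u xs w → ∃ λ ys → xs ≡ u ∷ ys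
  path-uncons stop    = _ , refl
  path-uncons (_ ◅ _) = _ , refl

  start∈ : ∀ {u xs w} → Path E u xs w → u ∈ₗ xs
  start∈ stop    = here refl
  start∈ (_ ◅ _) = here refl

  end∈ : ∀ {u xs w} → Path E u xs w → w ∈ₗ xs
  end∈ stop    = here refl
  end∈ (_ ◅ p) = there (end∈ p)

  append : ∀ {u xs v w ys z} → Path E u xs v → E v w → Path E w ys z → Path E u (xs ++ ys) z
  append stop    e q = e ◅ q
  append (d ◅ p) e q = d ◅ append p e q

  join : ∀ {u xs v ys w} → Path E u xs v → Path E v (v ∷ ys) w → Path E u (xs ++ ys) w
  join stop    q = q
  join (d ◅ p) q = d ◅ join p q

  path-split : ∀ xs {u a ys w} → Path E u (xs ++ a ∷ ys) w → Path E u (xs ++ [ a ]) a × Path E a (a ∷ ys) w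
  path-split []           stop    = stop , stop
  path-split []           (e ◅ p) = stop , e ◅ p
  path-split (x ∷ [])     (e ◅ p) = let q , r = path-split [] p in e ◅ q , r
  path-split (x ∷ y ∷ xs) (e ◅ p) = let q , r = path-split (y ∷ xs) p in e ◅ q , r

  path-prefix : ∀ x xs {u ys w} → Path E u (x ∷ xs ++ ys) w → ∃ λ v → Path E u (x ∷ xs) v
  path-prefix x []       stop    = _ , stop
  path-prefix x []       (_ ◅ _) = _ , stop
  path-prefix x (y ∷ xs) (e ◅ p) = let v , q = path-prefix y xs p in v , e ◅ q

  path-reverse : (∀ {u v} → E u v → E v u) → ∀ {u xs w} → Path E u xs w → Path E w (reverse xs) u
  path-reverse E-sym stop = stop
  path-reverse E-sym {u} {_ ∷ xs} (e ◅ p) =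
    subst (λ ys → Path E _ ys u) (≡-sym (unfold-reverse u xs)) (append (path-reverse E-sym p) (E-sym e) stop)

  path-lookup : ∀ {u xs w} → Path E u xs w → ∀ i j → suc (toℕ i) ≡ toℕ j → E (lookup xs i) (lookup xs j)
  path-lookup stop          zero    zero       ()
  path-lookup (e ◅ stop)    zero    (suc zero) eq = e
  path-lookup (e ◅ (_ ◅ _)) zero    (suc zero) eq = e
  path-lookup (e ◅ p)       (suc i) (suc j)    eq = path-lookup p i j (suc-injective eq)

  path-tabulate : ∀ m (p : Fin (suc m) → V) → (∀ i j → suc (toℕ i) ≡ toℕ j → E (p i) (p j)) →
                  ∃ λ w → Path E (p zero) (List.tabulate p) w
  path-tabulate zero    p adj = _ , stop
  path-tabulate (suc m) p adj = let w , q = path-tabulate m (p ∘ suc) (λ i j eq → adj (suc i) (suc j) (cong suc eq))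
                                in w , adj zero (suc zero) refl ◅ q

path-map : {V W : Set} {E : V → V → Set} {F : W → W → Set} {g : V → W} → (∀ {u v} → E u v → F (g u) (g v)) →
           ∀ {u xs w} → Path E u xs w → Path F (g u) (map g xs) (g w)
path-map E⇒F stop    = stop
path-map E⇒F (e ◅ p) = E⇒F e ◅ path-map E⇒F p

path⇒ContainsPath : ∀ {n} {G : Graph n} {k u xs w} → Path (Adj G) u xs w → Unique xs → k ≤ length xs → ContainsPath G k
path⇒ContainsPath {G = G} {xs = xs} p unique k≤ =
  (λ i → lookup xs (inject≤ i k≤)) ,
  (λ eq → inject≤-injective k≤ k≤ _ _ (lookup-injective unique eq)) ,
  (λ i j eq → path-lookup p _ _ (≡-trans (cong suc (toℕ-inject≤ i k≤)) (≡-trans eq (≡-sym (toℕ-inject≤ j k≤)))))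

-- Crossing chords

module Chords {V : Set} {E : V → V → Set} (E-sym : ∀ {u v} → E u v → E v u)
              {α β : V → Set} (α? : Decidable α) (β? : Decidable β) where

  -- What this excludes is a crossing pair of chords whose ends are consecutive on the path: such a
  -- pair would close a cycle through all of its vertices.
  Separated : List V → Set
  Separated xs = ∀ P {p q} Q → xs ≡ P ++ p ∷ q ∷ Q → β p → α q → ⊥

  consecutive? : ∀ xs → (∃₂ λ P Q → ∃₂ λ p q → xs ≡ P ++ p ∷ q ∷ Q × β p × α q) ⊎ Separated xs
  consecutive? []       = inj₂ λ { [] _ () ; (_ ∷ _) _ () }
  consecutive? (z ∷ []) = inj₂ λ { [] _ () ; (_ ∷ []) _ () ; (_ ∷ _ ∷ _) _ () }
  consecutive? (z ∷ y ∷ ys) with β? z ×-dec α? y | consecutive? (y ∷ ys)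
  ... | yes (βz , αy) | _ = inj₁ ([] , ys , z , y , refl , βz , αy)
  ... | no _   | inj₁ (P , Q , p , q , eq , βp , αq) = inj₁ (z ∷ P , Q , p , q , cong (z ∷_) eq , βp , αq)
  ... | no ¬βα | inj₂ separated = inj₂ λ
    { []      Q refl βp αq → ¬βα (βp , αq)
    ; (_ ∷ P) Q eq   βp αq → separated P Q (∷-injectiveʳ eq) βp αq }

  -- Each consecutive pair carries at most one of the two marks "`β` on the first vertex" and "`α`
  -- on the second". There are `length xs - 1` such pairs, and only `α` at the start and `β` at the
  -- end belong to no pair.
  separated-count : ∀ {u xs w} → Path E u xs w → Separated xs →
                    suc (# α? xs + # β? xs) ≤ length xs + (⟦ α? u ⟧ + ⟦ β? w ⟧)
  separated-count {u} stop separated =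
    ≤-reflexive (cong suc (cong₂ _+_ (+-identityʳ ⟦ α? u ⟧) (+-identityʳ ⟦ β? u ⟧)))
  separated-count {u} {_ ∷ xs} {w} (_◅_ {v = v} e p) separated = begin
    suc ((⟦ α? u ⟧ + # α? xs) + (⟦ β? u ⟧ + # β? xs))      ≡⟨ rearrange ⟦ α? u ⟧ ⟦ β? u ⟧ _ _ ⟩
    (⟦ α? u ⟧ + ⟦ β? u ⟧) + suc (# α? xs + # β? xs)
      ≤⟨ +-monoʳ-≤ (⟦ α? u ⟧ + ⟦ β? u ⟧) (separated-count p λ { P Q refl → separated (u ∷ P) Q refl }) ⟩
    (⟦ α? u ⟧ + ⟦ β? u ⟧) + (length xs + (⟦ α? v ⟧ + ⟦ β? w ⟧))
      ≡⟨ rearrange′ ⟦ α? u ⟧ ⟦ β? u ⟧ (length xs) ⟦ α? v ⟧ ⟦ β? w ⟧ ⟩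
    (⟦ β? u ⟧ + ⟦ α? v ⟧) + (length xs + (⟦ α? u ⟧ + ⟦ β? w ⟧))
      ≤⟨ +-monoˡ-≤ _ (at-most-one (path-uncons p)) ⟩
    suc (length xs + (⟦ α? u ⟧ + ⟦ β? w ⟧))                ∎
    where
    open ≤-Reasoning
    rearrange : ∀ a b c d → suc ((a + c) + (b + d)) ≡ (a + b) + suc (c + d)
    rearrange = solve-∀
    rearrange′ : ∀ a b c d e → (a + b) + (c + (d + e)) ≡ (b + d) + (c + (a + e))
    rearrange′ = solve-∀
    at-most-one : (∃ λ ys → xs ≡ v ∷ ys) → ⟦ β? u ⟧ + ⟦ α? v ⟧ ≤ 1
    at-most-one (ys , refl) with β? u | α? v
    ... | no _   | d      = ⟦⟧≤1 d
    ... | yes _  | no _   = ≤-refl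
    ... | yes βu | yes αv = ⊥-elim (separated [] ys refl βu αv)

  Unmarked : V → Set
  Unmarked v = ¬ α v × ¬ β v

  -- Scan from `p` towards `q`, with `M₀` the unmarked vertices passed so far: a `β`-vertex takes
  -- over the role of `p`, and an `α`-vertex ends the search as `q`. Nothing marked remains between
  -- the chosen pair.
  closest : ∀ M₀ M {p q Q} → All Unmarked M₀ → β p → α q →
            ∃₂ λ P′ p′ → ∃₂ λ M′ q′ → ∃ λ Q′ →
            p ∷ M₀ ++ M ++ q ∷ Q ≡ P′ ++ p′ ∷ M′ ++ q′ ∷ Q′ × β p′ × α q′ × All Unmarked M′
  closest M₀ [] unmarked βp αq = [] , _ , M₀ , _ , _ , refl , βp , αq , unmarked
  closest M₀ (m ∷ M) {p} {q} {Q} unmarked βp αq with β? m | α? m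
  ... | yes βm | _      = let P′ , p′ , M′ , q′ , Q′ , eq , rest = closest [] M [] βm αq in
    p ∷ M₀ ++ P′ , p′ , M′ , q′ , Q′ , cong (p ∷_) (≡-trans (cong (M₀ ++_) eq) (≡-sym (++-assoc M₀ P′ _))) , rest
  ... | no _   | yes αm = [] , p , M₀ , m , M ++ q ∷ Q , refl , βp , αm , unmarked
  ... | no ¬βm | no ¬αm = let P′ , p′ , M′ , q′ , Q′ , eq , rest = closest (M₀ ++ [ m ]) M (All.++⁺ unmarked ((¬αm , ¬βm) ∷ [])) βp αq in
    P′ , p′ , M′ , q′ , Q′ , ≡-trans (cong (p ∷_) (≡-sym (++-assoc M₀ [ m ] _))) eq , rest

  #-unmarked : ∀ {M} → All Unmarked M → # α? M + # β? M ≡ 0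
  #-unmarked {M} unmarked = cong₂ _+_ (#-none α? M λ v∈ → All.lookup unmarked v∈ .proj₁)
                                      (#-none β? M λ v∈ → All.lookup unmarked v∈ .proj₂)

  -- Two crossing chords x~q, y~p with p before q close up a cycle x … p y … q that skips the
  -- segment M between p and q.
  chords-cycle : ∀ {x y} P p M q Q → Path E x (P ++ p ∷ M ++ q ∷ Q) y → Unique (P ++ p ∷ M ++ q ∷ Q) → E y p → E x q →
                 Path E x ((P ++ [ p ]) ++ reverse (q ∷ Q)) q × Unique ((P ++ [ p ]) ++ reverse (q ∷ Q))
  chords-cycle P p M q Q path unique Eyp Exq =
    append start (E-sym Eyp) (path-reverse E-sym finish) ,
    Unique.++⁺ (unique-++⁻ (P ++ [ p ]) unique′ .proj₁)
               (unique-reverse (unique-++⁻ M (unique-++⁻ (P ++ [ p ]) unique′ .proj₂ .proj₁) .proj₂ .proj₁))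
               λ (v∈ , v∈Q) → unique-++⁻ (P ++ [ p ]) unique′ .proj₂ .proj₂ (v∈ , ∈-++⁺ʳ M (Any.reverse⁻ v∈Q))
    where
    start   = path-split P path .proj₁
    finish  = path-split (p ∷ M) (path-split P path .proj₂) .proj₂
    unique′ = subst Unique (≡-sym (++-assoc P [ p ] (M ++ q ∷ Q))) unique

  -- With a consecutive crossing pair the cycle covers the whole path. Otherwise the cycle of a
  -- closest pair loses only unmarked vertices, and `separated-count` on the two arcs it keeps
  -- bounds the number of marks by its length.
  crossing⇒cycle : ∀ {x y} P p M q Q → let xs = P ++ p ∷ M ++ q ∷ Q in
    Path E x xs y → Unique xs → (∀ {v} → α v → E x v) → (∀ {v} → β v → E y v) → ¬ α x → ¬ β y → β p → α q →
    ∃₂ λ cs w → Path E x cs w × E w x × Unique cs × (length xs ≤ length cs ⊎ # α? xs + # β? xs ≤ length cs)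
  crossing⇒cycle {x} {y} P p M q Q path unique α⇒ β⇒ ¬αx ¬βy βp αq
    with consecutive? (P ++ p ∷ M ++ q ∷ Q) | closest [] M {p} {q} {Q} [] βp αq
  ... | inj₁ (P′ , Q′ , p′ , q′ , eq , βp′ , αq′) | _ =
    let cycle , unique″ = chords-cycle P′ p′ [] q′ Q′ (subst (λ zs → Path E x zs y) eq path) (subst Unique eq unique) (β⇒ βp′) (α⇒ αq′)
    in _ , _ , cycle , E-sym (α⇒ αq′) , unique″ , inj₁ (≤-reflexive (≡-trans (cong length eq)
         (≡-trans (length-++ P′) (≡-sym (≡-trans (length-++ (P′ ++ [ p′ ])) (≡-trans (cong₂ _+_ (length-++ P′) (length-reverse (q′ ∷ Q′)))
           (+-assoc (length P′) 1 _)))))))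
  ... | inj₂ separated | P₁ , p′ , M′ , q′ , Q′ , eq₁ , βp′ , αq′ , unmarked =
    let P′ = P ++ P₁
        eq = ≡-trans (cong (P ++_) eq₁) (≡-sym (++-assoc P P₁ _))
        path′ = subst (λ zs → Path E x zs y) eq path
        cycle , unique″ = chords-cycle P′ p′ M′ q′ Q′ path′ (subst Unique eq unique) (β⇒ βp′) (α⇒ αq′)
    in _ , _ , cycle , E-sym (α⇒ αq′) , unique″ , inj₂ (subst (λ zs → # α? zs + # β? zs ≤ _) (≡-sym eq)
         (bound P′ p′ M′ q′ Q′ path′ (subst Separated eq separated) βp′ αq′ unmarked))
    where
    open ≤-Reasoning
    interchange : ∀ a b c d e f → (a + (b + c)) + (d + (e + f)) ≡ (a + d) + ((b + e) + (c + f))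
    interchange = solve-∀
    bound : ∀ P p M q Q → let xs = P ++ p ∷ M ++ q ∷ Q in Path E x xs y → Separated xs → β p → α q → All Unmarked M →
            # α? xs + # β? xs ≤ length ((P ++ [ p ]) ++ reverse (q ∷ Q))
    bound P p M q Q path separated βp αq unmarked = begin
      # α? xs + # β? xs
        ≡⟨ cong₂ _+_ (#-parts α?) (#-parts β?) ⟩
      (# α? xs₁ + (# α? M + # α? xs₂)) + (# β? xs₁ + (# β? M + # β? xs₂))
        ≡⟨ interchange (# α? xs₁) (# α? M) (# α? xs₂) (# β? xs₁) (# β? M) (# β? xs₂) ⟩
      (# α? xs₁ + # β? xs₁) + ((# α? M + # β? M) + (# α? xs₂ + # β? xs₂))
        ≡⟨ cong (λ m → (# α? xs₁ + # β? xs₁) + (m + (# α? xs₂ + # β? xs₂))) (#-unmarked unmarked) ⟩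
      (# α? xs₁ + # β? xs₁) + (# α? xs₂ + # β? xs₂)
        -- On each arc the two end marks add up to one: `p` has `β` but `x` lacks `α`, and `q` has
        -- `α` but `y` lacks `β`. This one cancels the `suc` of `separated-count`.
        ≤⟨ +-mono-≤ (drop-one (separated-count front separated₁) (cong₂ _+_ (⟦⟧-no (α? x) ¬αx) (⟦⟧-yes (β? p) βp)))
                    (drop-one (separated-count back separated₂) (cong₂ _+_ (⟦⟧-yes (α? q) αq) (⟦⟧-no (β? y) ¬βy))) ⟩
      length xs₁ + length xs₂
        ≡⟨ cong (length xs₁ +_) (length-reverse xs₂) ⟨
      length xs₁ + length (reverse xs₂)
        ≡⟨ length-++ xs₁ ⟨
      length (xs₁ ++ reverse xs₂) ∎
      where
      xs     = P ++ p ∷ M ++ q ∷ Q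
      xs₁    = P ++ [ p ]
      xs₂    = q ∷ Q
      xs≡    = ++-assoc P [ p ] (M ++ xs₂)
      front  = path-split P path .proj₁
      back = path-split (p ∷ M) (path-split P path .proj₂) .proj₂
      #-parts : ∀ {γ : V → Set} (γ? : Decidable γ) → # γ? xs ≡ # γ? xs₁ + (# γ? M + # γ? xs₂)
      #-parts γ? = ≡-trans (cong (# γ?) (≡-sym xs≡)) (≡-trans (#-++ γ? xs₁ _) (cong (# γ? xs₁ +_) (#-++ γ? M xs₂)))
      drop-one : ∀ {a b c} → suc a ≤ b + c → c ≡ 1 → a ≤ b
      drop-one {b = b} le refl rewrite +-comm b 1 = ≤-pred le
      separated₁ : Separated xs₁
      separated₁ P′ {p′} {q′} Q′ eq = separated P′ (Q′ ++ M ++ xs₂)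
        (≡-trans (≡-sym xs≡) (≡-trans (cong (_++ (M ++ xs₂)) eq) (++-assoc P′ (p′ ∷ q′ ∷ Q′) _)))
      separated₂ : Separated xs₂
      separated₂ P′ {p′} {q′} Q′ eq = separated (xs₁ ++ M ++ P′) Q′
        (≡-trans (≡-sym xs≡) (≡-trans (cong (λ zs → xs₁ ++ M ++ zs) eq)
          (≡-trans (cong (xs₁ ++_) (≡-sym (++-assoc M P′ _))) (≡-sym (++-assoc xs₁ (M ++ P′) _)))))

-- The graph with a universal vertex added

WithApex : (A → A → Set) → Maybe A → Maybe A → Set
WithApex E (just u) (just v) = E u v
WithApex E _        _        = Unit

apex-sym : {E : A → A → Set} → (∀ {u v} → E u v → E v u) → ∀ {u v} → WithApex E u v → WithApex E v u
apex-sym E-sym {just _}  {just _}  e = E-sym e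
apex-sym E-sym {just _}  {nothing} e = tt
apex-sym E-sym {nothing} {just _}  e = tt
apex-sym E-sym {nothing} {nothing} e = tt

allJust : ∀ (xs : List (Maybe A)) → nothing ∉ₗ xs → ∃ λ ys → xs ≡ map just ys
allJust []             nothing∉ = [] , refl
allJust (just x ∷ xs)  nothing∉ = let ys , eq = allJust xs (nothing∉ ∘ there) in x ∷ ys , cong (just x ∷_) eq
allJust (nothing ∷ xs) nothing∉ = contradiction (here refl) nothing∉

path-unjust : ∀ {E : A → A → Set} {u} ys {w} → Path (WithApex E) u (map just ys) w → ∃₂ λ u′ w′ → Path E u′ ys w′
path-unjust {E = E} ys p = let _ , _ , _ , _ , q = go ys p in _ , _ , q
  where
  go : ∀ {u w} ys → Path (WithApex E) u (map just ys) w → ∃₂ λ u′ w′ → u ≡ just u′ × w ≡ just w′ × Path E u′ ys w′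
  go (_ ∷ [])     stop    = _ , _ , refl , refl , stop
  go (_ ∷ y ∷ ys) (e ◅ p) with go (y ∷ ys) p
  ... | _ , _ , refl , refl , q = _ , _ , refl , refl , e ◅ q

apex-path⇒ContainsPath : ∀ {n} {G : Graph n} {k u w} xs → nothing ∉ₗ xs → Path (WithApex (Adj G)) u xs w → Unique xs →
                         k ≤ length xs → ContainsPath G k
apex-path⇒ContainsPath {G = G} {k} {u} {w} xs nothing∉ path unique k≤ with allJust xs nothing∉
... | ys , refl = let _ , _ , q = path-unjust ys path in
  path⇒ContainsPath {G = G} q (Unique.map⁻ unique) (≤-trans k≤ (≤-reflexive (length-map just ys)))

-- Deleting the apex from a cycle leaves a path with one vertex less: rotate the cycle to start and
-- end at the apex, then strip both ends. A cycle that misses the apex is long enough after dropping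
-- its closing edge.
apex-cycle⇒ContainsPath : ∀ {n} {G : Graph n} {k c w} cs → Path (WithApex (Adj G)) c cs w → WithApex (Adj G) w c → Unique cs →
                          1 ≤ k → suc k ≤ length cs → ContainsPath G k
apex-cycle⇒ContainsPath {n} {G} {k} {c} {w} cs path closing unique 1≤k k< with memberOf (Maybe.≡-dec Fin._≟_) nothing cs
... | no nothing∉  = apex-path⇒ContainsPath {G = G} cs nothing∉ path unique (<⇒≤ k<)
... | yes nothing∈ with ∈-∃++ nothing∈
...   | l , r , refl = rotated (r ++ l) refl
  where
  unique⁻ = unique-++⁻ l unique
  r-unique = unique-++⁻ [ nothing ] (unique⁻ .proj₂ .proj₁)
  rotation : Path (WithApex (Adj G)) nothing (nothing ∷ (r ++ l) ++ [ nothing ]) nothing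
  rotation = subst (λ zs → Path (WithApex (Adj G)) nothing zs nothing) (cong (nothing ∷_) (≡-sym (++-assoc r l _)))
    (append (path-split l path .proj₂) closing (path-split l path .proj₁))
  rotation-unique : Unique (r ++ l)
  rotation-unique = Unique.++⁺ (r-unique .proj₂ .proj₁) (unique⁻ .proj₁)
    λ (v∈r , v∈l) → unique⁻ .proj₂ .proj₂ (v∈l , there v∈r)
  nothing∉ : nothing ∉ₗ r ++ l
  nothing∉ v∈ with ∈-++⁻ r v∈
  ... | inj₁ v∈r = r-unique .proj₂ .proj₂ (here refl , v∈r)
  ... | inj₂ v∈l = unique⁻ .proj₂ .proj₂ (v∈l , here refl)
  rotation-length : suc (length (r ++ l)) ≡ length (l ++ nothing ∷ r)
  rotation-length = ≡-trans (cong suc (length-++ r)) (≡-trans (+-comm (suc (length r)) (length l)) (≡-sym (length-++ l)))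
  k≤ : k ≤ length (r ++ l)
  k≤ = ≤-pred (≤-trans k< (≤-reflexive (≡-sym rotation-length)))
  -- The list is generalised so that its first vertex can be matched; it is nonempty because `k` is
  -- positive.
  rotated : ∀ m → m ≡ r ++ l → ContainsPath G k
  rotated []       eq = contradiction (≤-trans 1≤k (subst (λ m → k ≤ length m) (≡-sym eq) k≤)) λ ()
  rotated (y ∷ ys) eq with subst (λ m → Path (WithApex (Adj G)) nothing (nothing ∷ m ++ [ nothing ]) nothing) (≡-sym eq) rotation
  ... | _ ◅ p = apex-path⇒ContainsPath {G = G} (y ∷ ys) (subst (nothing ∉ₗ_) (≡-sym eq) nothing∉) (path-prefix y ys p .proj₂)
                  (subst Unique (≡-sym eq) rotation-unique) (subst (λ m → k ≤ length m) (≡-sym eq) k≤)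

-- Rerouting a path along a chord

first? : {P : A → Set} (P? : Decidable P) → ∀ xs →
         (∃₂ λ M a → ∃ λ D → xs ≡ M ++ a ∷ D × P a × (∀ {v} → v ∈ₗ M → ¬ P v)) ⊎ (∀ {v} → v ∈ₗ xs → ¬ P v)
first? P? [] = inj₂ λ ()
first? P? (x ∷ xs) with P? x | first? P? xs
... | yes p | _ = inj₁ ([] , x , xs , refl , p , λ ())
... | no ¬p | inj₁ (M , a , D , eq , pa , none) = inj₁ (x ∷ M , a , D , cong (x ∷_) eq , pa , λ { (here refl) → ¬p ; (there v∈) → none v∈ })
... | no ¬p | inj₂ none = inj₂ λ { (here refl) → ¬p ; (there v∈) → none v∈ }

#<length : {P : A → Set} (P? : Decidable P) {E : A → A → Set} → ∀ {u xs w} → Path E u xs w → ¬ P u → # P? xs < length xs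
#<length P? {u = u} stop                 ¬p rewrite ⟦⟧-no (P? u) ¬p = s≤s z≤n
#<length P? {u = u} (_◅_ {xs = xs} e p) ¬p rewrite ⟦⟧-no (P? u) ¬p = s≤s (#-≤-length P? xs)

-- With a the first chord end after u, the path runs from the far end back to a, jumps to x and
-- follows the original path up to u, losing only unmarked vertices.
reroute : ∀ {E : A → A → Set} → (∀ {u v} → E u v → E v u) → {α : A → Set} (α? : Decidable α) →
          ∀ {x xs e u} → Path E x xs e → Unique xs → (∀ {v} → α v → E x v) → ¬ α x → u ∈ₗ xs →
          ∃₂ λ s ys → Path E s ys u × Unique ys × (∀ {v} → v ∈ₗ ys → v ∈ₗ xs) × # α? xs < length ys
reroute {E = E} E-sym {α} α? {x} {xs} {e} {u} path unique α⇒ ¬αx u∈ with ∈-∃++ u∈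
... | U , r , refl with first? α? r
-- No chord ends beyond `u`, so the initial segment up to `u` already holds all the marks; the
-- unmarked start `x` makes the inequality strict.
...   | inj₂ none = _ , U ++ [ u ] , front , unique-++⁻ (U ++ [ u ]) unique′ .proj₁ ,
        (λ v∈ → subst (_ ∈ₗ_) (++-assoc U [ u ] r) (∈-++⁺ˡ v∈)) ,
        ≤-trans (s≤s (≤-reflexive count)) (#<length α? front ¬αx)
  where
  front = path-split U path .proj₁
  unique′ = subst Unique (≡-sym (++-assoc U [ u ] r)) unique
  count : # α? (U ++ u ∷ r) ≡ # α? (U ++ [ u ])
  count = ≡-trans (cong (# α?) (≡-sym (++-assoc U [ u ] r)))
    (≡-trans (#-++ α? (U ++ [ u ]) r) (≡-trans (cong (_ +_) (#-none α? r none)) (+-identityʳ _)))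
...   | inj₁ (M , a , D , refl , αa , none) = _ , reverse (a ∷ D) ++ (U ++ [ u ]) ,
        append (path-reverse E-sym back) (E-sym (α⇒ αa)) front ,
        Unique.++⁺ (unique-reverse (unique-++⁻ M (unique⁻ .proj₂ .proj₁) .proj₂ .proj₁)) (unique⁻ .proj₁)
          (λ (v∈D , v∈U) → unique⁻ .proj₂ .proj₂ (v∈U , ∈-++⁺ʳ M (Any.reverse⁻ v∈D))) ,
        subset , bound
  where
  open ≤-Reasoning
  front = path-split U path .proj₁
  back = path-split (u ∷ M) (path-split U path .proj₂) .proj₂
  xs≡ = ++-assoc U [ u ] (M ++ a ∷ D)
  unique⁻ = unique-++⁻ (U ++ [ u ]) (subst Unique (≡-sym xs≡) unique)
  subset : ∀ {v} → v ∈ₗ reverse (a ∷ D) ++ (U ++ [ u ]) → v ∈ₗ U ++ u ∷ M ++ a ∷ D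
  subset v∈ with ∈-++⁻ (reverse (a ∷ D)) v∈
  ... | inj₁ v∈D = ∈-++⁺ʳ U (there (∈-++⁺ʳ M (Any.reverse⁻ v∈D)))
  ... | inj₂ v∈U = subst (_ ∈ₗ_) xs≡ (∈-++⁺ˡ v∈U)
  bound : # α? (U ++ u ∷ M ++ a ∷ D) < length (reverse (a ∷ D) ++ (U ++ [ u ]))
  bound = begin-strict
    # α? (U ++ u ∷ M ++ a ∷ D)                          ≡⟨ cong (# α?) xs≡ ⟨
    # α? ((U ++ [ u ]) ++ M ++ a ∷ D)                   ≡⟨ #-++ α? (U ++ [ u ]) _ ⟩
    # α? (U ++ [ u ]) + # α? (M ++ a ∷ D)               ≡⟨ cong (# α? (U ++ [ u ]) +_) (#-++ α? M _) ⟩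
    # α? (U ++ [ u ]) + (# α? M + # α? (a ∷ D))         ≡⟨ cong (λ m → # α? (U ++ [ u ]) + (m + # α? (a ∷ D))) (#-none α? M none) ⟩
    # α? (U ++ [ u ]) + # α? (a ∷ D)                    <⟨ +-mono-<-≤ (#<length α? front ¬αx) (#-≤-length α? (a ∷ D)) ⟩
    length (U ++ [ u ]) + length (a ∷ D)                ≡⟨ +-comm (length (U ++ [ u ])) _ ⟩
    length (a ∷ D) + length (U ++ [ u ])                ≡⟨ cong (_+ length (U ++ [ u ])) (length-reverse (a ∷ D)) ⟨
    length (reverse (a ∷ D)) + length (U ++ [ u ])      ≡⟨ length-++ (reverse (a ∷ D)) ⟨
    length (reverse (a ∷ D) ++ (U ++ [ u ]))            ∎

-- Linking two disjoint sets

module _ {n} (G : Graph n) (L T : List (Fin n)) where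

  private
    _∈?ₗ_ = memberOf (Fin._≟_ {n})

  record Link : Set where
    field
      {u z}  : Fin n
      {r}    : List (Fin n)
      u∈L    : u ∈ₗ L
      z∈T    : z ∈ₗ T
      path   : Path (Adj G) u (u ∷ r) z
      unique : Unique (u ∷ r)
      avoidL : ∀ {v} → v ∈ₗ r → v ∉ₗ L
      onlyz  : ∀ {v} → v ∈ₗ u ∷ r → v ∈ₗ T → v ≡ z

  -- An unfinished link during the recursion along a walk: it has reached `T` at its far end but has
  -- not yet met `L`.
  record Tail (a : Fin n) : Set where
    field
      {z}    : Fin n
      {xs}   : List (Fin n)
      z∈T    : z ∈ₗ T
      path   : Path (Adj G) a xs z
      unique : Unique xs
      avoidL : ∀ {v} → v ∈ₗ xs → v ∉ₗ L
      onlyz  : ∀ {v} → v ∈ₗ xs → v ∈ₗ T → v ≡ z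

  -- The walk is processed from its far end: a vertex of `T` restarts the path, a vertex of `L`
  -- completes the link, and a repeated vertex cuts out the detour between its two visits.
  link-or-tail : Disjoint L T → ∀ {a b} → Walk G a b → b ∈ₗ T → Link ⊎ Tail a
  link-or-tail disjoint here b∈T = inj₂ record
    { z∈T = b∈T ; path = stop ; unique = [] ∷ [] ; avoidL = λ { (here refl) b∈L → disjoint (b∈L , b∈T) } ; onlyz = λ { (here refl) _ → refl } }
  link-or-tail disjoint {a} (step e walk) b∈T with a ∈?ₗ T
  ... | yes a∈T = inj₂ record
    { z∈T = a∈T ; path = stop ; unique = [] ∷ [] ; avoidL = λ { (here refl) a∈L → disjoint (a∈L , a∈T) } ; onlyz = λ { (here refl) _ → refl } }
  ... | no a∉T with link-or-tail disjoint walk b∈T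
  ...   | inj₁ link = inj₁ link
  ...   | inj₂ tail with a ∈?ₗ L
  ...     | yes a∈L = inj₁ record
    { u∈L = a∈L ; z∈T = z∈T ; path = e ◅ path ; unique = unique-∷ (λ a∈ → avoidL a∈ a∈L) unique ; avoidL = avoidL
    ; onlyz = λ { (here refl) v∈T → contradiction v∈T a∉T ; (there v∈) → onlyz v∈ } }
    where open Tail tail
  ...     | no a∉L with a ∈?ₗ Tail.xs tail
  ...       | no a∉ = inj₂ record
    { z∈T = z∈T ; path = e ◅ path ; unique = unique-∷ a∉ unique ; avoidL = λ { (here refl) → a∉L ; (there v∈) → avoidL v∈ }
    ; onlyz = λ { (here refl) v∈T → contradiction v∈T a∉T ; (there v∈) → onlyz v∈ } }
    where open Tail tail
  ...       | yes a∈ = inj₂ (shortcut (∈-∃++ a∈))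
    where
    open Tail tail
    shortcut : (∃₂ λ ys zs → xs ≡ ys ++ a ∷ zs) → Tail a
    shortcut (ys , zs , eq) = record
      { z∈T = z∈T
      ; path = path-split ys (subst (λ ws → Path (Adj G) _ ws z) eq path) .proj₂
      ; unique = unique-++⁻ ys (subst Unique eq unique) .proj₂ .proj₁
      ; avoidL = avoidL ∘ back ; onlyz = onlyz ∘ back }
      where
      back : ∀ {v} → v ∈ₗ a ∷ zs → v ∈ₗ xs
      back v∈ = subst (_ ∈ₗ_) (≡-sym eq) (∈-++⁺ʳ ys v∈)

  link : Disjoint L T → ∀ {a b} → Walk G a b → a ∈ₗ L → b ∈ₗ T → Link
  link disjoint walk a∈L b∈T with link-or-tail disjoint walk b∈T
  ... | inj₁ l = l
  ... | inj₂ t = contradiction a∈L (Tail.avoidL t (start∈ (Tail.path t)))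

-- Pósa's lemma

-- The apex is adjacent to every vertex, so it joins whatever neighbourhood `N` is considered.
Marked : ∀ {n} → Subset n → Maybe (Fin n) → Set
Marked N (just v) = v ∈ N
Marked N nothing  = Unit

marked? : ∀ {n} (N : Subset n) → Decidable (Marked N)
marked? N (just v) = v ∈? N
marked? N nothing  = yes tt

module Pósa {n} (G : Graph n) (connected : Connected G) {k} (1≤k : 1 ≤ k)
            {x y a b A B} (pathA : Path (Adj G) x A a) (pathB : Path (Adj G) y B b) (unique : Unique (A ++ B))
            (NX NY : Subset n) (NX⇒ : ∀ {v} → v ∈ NX → Adj G x v) (NY⇒ : ∀ {v} → v ∈ NY → Adj G y v)
            (NX⊆ : ∀ {v} → v ∈ NX → v ∈ₗ A ++ B) (NY⊆ : ∀ {v} → v ∈ NY → v ∈ₗ A ++ B)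
            (k≤degrees : k ≤ suc (∣ NX ∣ + ∣ NY ∣)) (k≤length : k ≤ length A + length B) where

  private
    uniqueA  = unique-++⁻ A unique .proj₁
    uniqueB  = unique-++⁻ A unique .proj₂ .proj₁
    disjoint = unique-++⁻ A unique .proj₂ .proj₂
    B⃖ = reverse B

    E : Maybe (Fin n) → Maybe (Fin n) → Set
    E = WithApex (Adj G)

    -- Reversing `B` puts the starting vertices `x` and `y` at the two ends of one path through the
    -- apex.
    V : List (Maybe (Fin n))
    V = map just A ++ nothing ∷ map just B⃖

    pathV : Path E (just x) V (just y)
    pathV = append (path-map (λ e → e) pathA) tt (tt ◅ path-map (λ e → e) (path-reverse (Graph.sym G) pathB))

    nothing∉ : ∀ {xs : List (Fin n)} → nothing ∉ₗ map just xs
    nothing∉ nothing∈ with ∈-map⁻ just nothing∈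
    ... | _ , _ , ()

    uniqueV : Unique V
    uniqueV = Unique.++⁺ (Unique.map⁺ Maybe.just-injective uniqueA)
      (unique-∷ nothing∉ (Unique.map⁺ Maybe.just-injective (unique-reverse uniqueB))) λ
      { (v∈ , here refl) → nothing∉ v∈
      ; (v∈ , there v∈′) → case (∈-map⁻ just v∈) (∈-map⁻ just v∈′) }
      where
      case : ∀ {v} → (∃ λ u → u ∈ₗ A × v ≡ just u) → (∃ λ u → u ∈ₗ B⃖ × v ≡ just u) → ⊥
      case (_ , u∈A , refl) (_ , u∈B , refl) = disjoint (u∈A , Any.reverse⁻ u∈B)

    lengthV : suc k ≤ length V
    lengthV = begin
      suc k                                ≤⟨ s≤s k≤length ⟩
      suc (length A + length B)            ≡⟨ +-suc (length A) (length B) ⟨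
      length A + suc (length B)            ≡⟨ cong₂ (λ l m → l + suc m) (length-map just A) (≡-trans (length-map just B⃖) (length-reverse B)) ⟨
      length (map just A) + suc (length (map just B⃖))  ≡⟨ length-++ (map just A) ⟨
      length V                             ∎
      where open ≤-Reasoning

    countV : ∀ N → (∀ {v} → v ∈ N → v ∈ₗ A ++ B) → suc ∣ N ∣ ≤ # (marked? N) V
    countV N N⊆ = begin
      suc ∣ N ∣                                      ≤⟨ s≤s (card-≤-# N (A ++ B⃖) ⊆-reversed) ⟩
      suc (# (_∈? N) (A ++ B⃖))                      ≡⟨ cong suc (#-++ (_∈? N) A B⃖) ⟩
      suc (# (_∈? N) A + # (_∈? N) B⃖)               ≡⟨ +-suc (# (_∈? N) A) _ ⟨
      # (_∈? N) A + suc (# (_∈? N) B⃖)               ≡⟨ cong₂ (λ l m → l + suc m) (#-map just (marked? N) A) (#-map just (marked? N) B⃖) ⟨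
      # (marked? N) (map just A) + suc (# (marked? N) (map just B⃖))  ≡⟨ #-++ (marked? N) (map just A) _ ⟨
      # (marked? N) V                                ∎
      where
      open ≤-Reasoning
      ⊆-reversed : ∀ {v} → v ∈ N → v ∈ₗ A ++ B⃖
      ⊆-reversed v∈ with ∈-++⁻ A (N⊆ v∈)
      ... | inj₁ v∈A = ∈-++⁺ˡ v∈A
      ... | inj₂ v∈B = ∈-++⁺ʳ A (Any.reverse⁺ v∈B)

    countsV : suc k ≤ # (marked? NX) V + # (marked? NY) V
    countsV = begin
      suc k                              ≤⟨ s≤s k≤degrees ⟩
      suc (suc (∣ NX ∣ + ∣ NY ∣))          ≡⟨ cong suc (+-suc ∣ NX ∣ ∣ NY ∣) ⟨
      suc ∣ NX ∣ + suc ∣ NY ∣              ≤⟨ +-mono-≤ (countV NX NX⊆) (countV NY NY⊆) ⟩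
      # (marked? NX) V + # (marked? NY) V ∎
      where open ≤-Reasoning

    marked⇒ : ∀ {N u} → (∀ {v} → v ∈ N → Adj G u v) → ∀ {v} → Marked N v → E (just u) v
    marked⇒ N⇒ {just _}  v∈ = N⇒ v∈
    marked⇒ N⇒ {nothing} _  = tt

  -- Both outcomes for the cycle give more than `k` vertices: the glued path has one vertex, the
  -- apex, beyond `A` and `B`, and the apex adds one mark of each kind, so there are at least
  -- `∣ NX ∣ + ∣ NY ∣ + 2` marks.
  crossing : ∀ P p M q Q → V ≡ P ++ p ∷ M ++ q ∷ Q → Marked NY p → Marked NX q → ContainsPath G k
  crossing P p M q Q eq βp αq = finish (Chords.crossing⇒cycle {E = E} (λ {u} {v} → apex-sym {E = Adj G} (Graph.sym G) {u} {v}) (marked? NX) (marked? NY) P p M q Q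
      (subst (λ zs → Path E (just x) zs (just y)) eq pathV) (subst Unique eq uniqueV)
      (λ {v} → marked⇒ NX⇒ {v}) (λ {v} → marked⇒ NY⇒ {v}) (irrefl G ∘ NX⇒) (irrefl G ∘ NY⇒) βp αq)
    where
    xs = P ++ p ∷ M ++ q ∷ Q
    finish : (∃₂ λ cs w → Path E (just x) cs w × E w (just x) × Unique cs ×
               (length xs ≤ length cs ⊎ # (marked? NX) xs + # (marked? NY) xs ≤ length cs)) → ContainsPath G k
    finish (cs , w , cycle , closing , u , inj₁ le) = apex-cycle⇒ContainsPath {G = G} cs cycle closing u 1≤k
      (≤-trans lengthV (≤-trans (≤-reflexive (cong length eq)) le))
    finish (cs , w , cycle , closing , u , inj₂ le) = apex-cycle⇒ContainsPath {G = G} cs cycle closing u 1≤k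
      (≤-trans countsV (≤-trans (≤-reflexive (cong (λ zs → # (marked? NX) zs + # (marked? NY) zs) eq)) le))

  -- Now `NX` lies on `A` and `NY` on `B`. Connectivity gives a link from `A` to `B`, and `reroute`
  -- leads a path with more than `∣ NX ∣` vertices of `A` to one end of the link and one with more
  -- than `∣ NY ∣` vertices of `B` to the other.
  noncrossing : (∀ {v} → v ∈ₗ A → v ∉ NY) → (∀ {v} → v ∈ₗ B → v ∉ NX) → ContainsPath G k
  noncrossing NY∩A NX∩B = finish
    (link G A B disjoint (connected x y) (start∈ pathA) (start∈ pathB))
    where
    open ≤-Reasoning
    NX⊆A : ∀ {v} → v ∈ NX → v ∈ₗ A
    NX⊆A v∈ with ∈-++⁻ A (NX⊆ v∈)
    ... | inj₁ v∈A = v∈A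
    ... | inj₂ v∈B = contradiction v∈ (NX∩B v∈B)
    NY⊆B : ∀ {v} → v ∈ NY → v ∈ₗ B
    NY⊆B v∈ with ∈-++⁻ A (NY⊆ v∈)
    ... | inj₁ v∈A = contradiction v∈ (NY∩A v∈A)
    ... | inj₂ v∈B = v∈B
    finish : Link G A B → ContainsPath G k
    finish l with reroute (Graph.sym G) (_∈? NX) pathA uniqueA NX⇒ (irrefl G ∘ NX⇒) (Link.u∈L l)
                | reroute (Graph.sym G) (_∈? NY) pathB uniqueB NY⇒ (irrefl G ∘ NY⇒) (Link.z∈T l)
    ... | s , as , path₁ , unique₁ , as⊆ , as> | t , bs , path₂ , unique₂ , bs⊆ , bs>
      with path-uncons (path-reverse (Graph.sym G) path₂)
    ... | cs , bs≡ = path⇒ContainsPath {G = G}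
        (join (join path₁ path) (subst (λ zs → Path (Adj G) z zs t) bs≡ (path-reverse (Graph.sym G) path₂)))
        (Unique.++⁺ (Unique.++⁺ unique₁ (unique-++⁻ [ u ] unique′ .proj₂ .proj₁) λ (v∈as , v∈r) → avoidL v∈r (as⊆ v∈as))
                    (unique-++⁻ [ z ] unique₃ .proj₂ .proj₁)
                    λ (v∈ , v∈cs) → separate (∈-++⁻ as v∈) v∈cs)
        (begin
          k                                        ≤⟨ k≤degrees ⟩
          suc (∣ NX ∣ + ∣ NY ∣)                     ≤⟨ s≤s (+-mono-≤ (card-≤-# NX A NX⊆A) (card-≤-# NY B NY⊆B)) ⟩
          -- The vertex `z` belongs to the link already, so the second path contributes only `cs`,
          -- which is one shorter than `bs`.
          suc (# (_∈? NX) A) + # (_∈? NY) B        ≤⟨ +-mono-≤ as> (≤-pred (≤-trans bs> (≤-reflexive bs-length))) ⟩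
          length as + length cs                    ≤⟨ +-monoˡ-≤ (length cs) (m≤m+n (length as) (length r)) ⟩
          (length as + length r) + length cs       ≡⟨ cong (_+ length cs) (length-++ as) ⟨
          length (as ++ r) + length cs             ≡⟨ length-++ (as ++ r) ⟨
          length ((as ++ r) ++ cs)                 ∎)
      where
      open Link l renaming (unique to unique′)
      unique₃ : Unique (z ∷ cs)
      unique₃ = subst Unique bs≡ (unique-reverse unique₂)
      bs-length : length bs ≡ suc (length cs)
      bs-length = ≡-trans (≡-sym (length-reverse bs)) (cong length bs≡)
      cs⊆ : ∀ {v} → v ∈ₗ cs → v ∈ₗ B
      cs⊆ v∈ = bs⊆ (Any.reverse⁻ (subst (_ ∈ₗ_) (≡-sym bs≡) (there v∈)))
      separate : ∀ {v} → v ∈ₗ as ⊎ v ∈ₗ r → v ∈ₗ cs → ⊥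
      separate (inj₁ v∈as) v∈cs = disjoint (as⊆ v∈as , cs⊆ v∈cs)
      separate (inj₂ v∈r)  v∈cs with onlyz (there v∈r) (cs⊆ v∈cs)
      ... | refl = Unique.Unique[x∷xs]⇒x∉xs unique₃ v∈cs

  -- The apex itself can be one end of a crossing pair, being marked for both `x` and `y`: a vertex
  -- of `NY` on `A` comes before it, and a vertex of `NX` on `B` comes after it.
  longPath : ContainsPath G k
  longPath with first? (_∈? NY) A | first? (_∈? NX) B⃖
  ... | inj₁ (A₁ , v , A₂ , refl , v∈NY , _) | _ =
    crossing (map just A₁) (just v) (map just A₂) nothing (map just B⃖)
      (≡-trans (cong (_++ nothing ∷ map just B⃖) (map-++ just A₁ (v ∷ A₂))) (++-assoc (map just A₁) (map just (v ∷ A₂)) _)) v∈NY tt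
  ... | inj₂ _ | inj₁ (B₁ , v , B₂ , eq , v∈NX , _) =
    crossing (map just A) nothing (map just B₁) (just v) (map just B₂)
      (cong (λ zs → map just A ++ nothing ∷ zs) (≡-trans (cong (map just) eq) (map-++ just B₁ (v ∷ B₂)))) tt v∈NX
  ... | inj₂ NY∩A | inj₂ NX∩B = noncrossing NY∩A (NX∩B ∘ Any.reverse⁺)

-- Saturation

addEdge : ∀ {n} (G : Graph n) {x y : Fin n} → x ≢ y → Graph n
addEdge G {x} {y} x≢y = record
  { Adj    = λ u v → Adj G u v ⊎ ((u ≡ x × v ≡ y) ⊎ (u ≡ y × v ≡ x))
  ; adj?   = λ u v → adj? G u v ⊎-dec (((u Fin.≟ x) ×-dec (v Fin.≟ y)) ⊎-dec ((u Fin.≟ y) ×-dec (v Fin.≟ x)))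
  ; sym    = λ { (inj₁ e) → inj₁ (Graph.sym G e)
               ; (inj₂ (inj₁ (u≡ , v≡))) → inj₂ (inj₂ (v≡ , u≡))
               ; (inj₂ (inj₂ (u≡ , v≡))) → inj₂ (inj₁ (v≡ , u≡)) }
  ; irrefl = λ { (inj₁ e) → irrefl G e
               ; (inj₂ (inj₁ (refl , u≡y))) → x≢y u≡y
               ; (inj₂ (inj₂ (refl , u≡x))) → x≢y (≡-sym u≡x) } }

_⊑_ : ∀ {n} → Graph n → Graph n → Set
G ⊑ H = ∀ {u v} → Adj G u v → Adj H u v

ContainsPath-mono : ∀ {n} {G H : Graph n} {k} → G ⊑ H → ContainsPath G k → ContainsPath H k
ContainsPath-mono G⊑H (p , injective , adj) = p , injective , λ i j eq → G⊑H (adj i j eq)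

addEdge-mono : ∀ {n} {G H : Graph n} {x y} (x≢y x≢y′ : x ≢ y) → G ⊑ H → addEdge G x≢y ⊑ addEdge H x≢y′
addEdge-mono _ _ G⊑H (inj₁ e)   = inj₁ (G⊑H e)
addEdge-mono _ _ G⊑H (inj₂ new) = inj₂ new

SaturatedAt : ∀ {n} → ℕ → Graph n → Fin n → Fin n → Set
SaturatedAt k G x y = (x≢y : x ≢ y) → Adj G x y ⊎ ContainsPath (addEdge G x≢y) k

-- Each pair is treated once: if its edge creates no path on `k` vertices it is added, otherwise the
-- path that blocks it persists as further edges are added. Which case holds is not decided, hence
-- the double negation: the branch that adds the edge is run first, and `blocked` refutes the path
-- by completing the other branch.
¬¬saturate : ∀ {n} k (pairs : List (Fin n × Fin n)) (G : Graph n) → ¬ ContainsPath G k →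
             ((H : Graph n) → G ⊑ H → ¬ ContainsPath H k → (∀ {x y} → (x , y) ∈ₗ pairs → SaturatedAt k H x y) → ⊥) → ⊥
¬¬saturate k [] G P-free goal = goal G (λ e → e) P-free λ ()
¬¬saturate k ((x , y) ∷ pairs) G P-free goal with x Fin.≟ y
... | yes refl = ¬¬saturate k pairs G P-free λ H G⊑H H-free saturated → goal H G⊑H H-free λ
  { (here refl) x≢x → contradiction refl x≢x
  ; (there xy∈) → saturated xy∈ }
... | no x≢y = ¬¬saturate k pairs (addEdge G x≢y) blocked λ H G⁺⊑H H-free saturated → goal H (λ e → G⁺⊑H (inj₁ e)) H-free λ
  { (here refl) _ → inj₁ (G⁺⊑H (inj₂ (inj₁ (refl , refl))))
  ; (there xy∈) → saturated xy∈ }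
  where
  blocked : ¬ ContainsPath (addEdge G x≢y) k
  blocked path = ¬¬saturate k pairs G P-free λ H G⊑H H-free saturated → goal H G⊑H H-free λ
    { (here refl) x≢y′ → inj₂ (ContainsPath-mono {G = addEdge G x≢y} {addEdge H x≢y′} (addEdge-mono {G = G} {H} x≢y x≢y′ G⊑H) path)
    ; (there xy∈) → saturated xy∈ }

-- A path with distinct vertices uses the new edge at most once, because a second use would return
-- to the vertex left by the first. The two alternatives are the two directions of that use.
split-at-edge : ∀ {n} {G : Graph n} {x y : Fin n} {x≢y : x ≢ y} {u xs w} → Path (Adj (addEdge G x≢y)) u xs w → Unique xs →
                Path (Adj G) u xs w ⊎ ∃₂ λ A B → xs ≡ A ++ B ×
                (Path (Adj G) u A x × Path (Adj G) y B w ⊎ Path (Adj G) u A y × Path (Adj G) x B w)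
split-at-edge stop _ = inj₁ stop
split-at-edge {G = G} {x≢y = x≢y} (e ◅ p) u@(_ ∷ u′) with e | split-at-edge {G = G} {x≢y = x≢y} p u′
... | inj₁ e′ | inj₁ q = inj₁ (e′ ◅ q)
... | inj₁ e′ | inj₂ (A , B , refl , inj₁ (q , r)) = inj₂ (_ ∷ A , B , refl , inj₁ (e′ ◅ q , r))
... | inj₁ e′ | inj₂ (A , B , refl , inj₂ (q , r)) = inj₂ (_ ∷ A , B , refl , inj₂ (e′ ◅ q , r))
... | inj₂ (inj₁ (refl , refl)) | inj₁ q = inj₂ ([ _ ] , _ , refl , inj₁ (stop , q))
... | inj₂ (inj₁ (refl , refl)) | inj₂ (A , B , refl , inj₁ (q , _)) = contradiction (∈-++⁺ˡ (end∈ q)) (Unique.Unique[x∷xs]⇒x∉xs u)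
... | inj₂ (inj₁ (refl , refl)) | inj₂ (A , B , refl , inj₂ (_ , r)) = contradiction (∈-++⁺ʳ A (start∈ r)) (Unique.Unique[x∷xs]⇒x∉xs u)
... | inj₂ (inj₂ (refl , refl)) | inj₁ q = inj₂ ([ _ ] , _ , refl , inj₂ (stop , q))
... | inj₂ (inj₂ (refl , refl)) | inj₂ (A , B , refl , inj₁ (_ , r)) = contradiction (∈-++⁺ʳ A (start∈ r)) (Unique.Unique[x∷xs]⇒x∉xs u)
... | inj₂ (inj₂ (refl , refl)) | inj₂ (A , B , refl , inj₂ (q , _)) = contradiction (∈-++⁺ˡ (end∈ q)) (Unique.Unique[x∷xs]⇒x∉xs u)

-- Disjoint paths in saturated graphs

module Saturated {n} (G : Graph n) (connected : Connected G) {k} (1≤k : 1 ≤ k) (P-free : ¬ ContainsPath G k)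
                 (saturated : ∀ x y → SaturatedAt k G x y) where

  record TwoPaths (x y : Fin n) : Set where
    constructor twoPaths
    field
      {xs ys} : List (Fin n)
      {a b}   : Fin n
      pathA   : Path (Adj G) x xs a
      pathB   : Path (Adj G) y ys b
      unique  : Unique (xs ++ ys)
      k≤      : k ≤ length xs + length ys

  -- Saturation yields a path on `k` vertices once `xy` is added. It must use `xy`, and cutting it
  -- there leaves two pieces; one is reversed so that they start at `x` and `y`.
  nonadjacent⇒TwoPaths : ∀ {x y} → x ≢ y → ¬ Adj G x y → TwoPaths x y
  nonadjacent⇒TwoPaths {x} {y} x≢y ¬adj with saturated x y x≢y
  ... | inj₁ adj = contradiction adj ¬adj
  ... | inj₂ (p , injective , adj) = cut k refl p injective adj
    where
    cut : ∀ k′ → k ≡ k′ → (p : Fin k′ → Fin n) → Injective _≡_ _≡_ p →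
          (∀ i j → suc (toℕ i) ≡ toℕ j → Adj (addEdge G x≢y) (p i) (p j)) → TwoPaths x y
    cut zero    refl = contradiction 1≤k λ ()
    cut (suc m) refl p injective adj with split-at-edge {G = G} {x≢y = x≢y} (path-tabulate m p adj .proj₂) (Unique.tabulate⁺ injective)
    ... | inj₁ path = ⊥-elim (P-free (path⇒ContainsPath {G = G} path (Unique.tabulate⁺ injective) (≤-reflexive (≡-sym (length-tabulate p)))))
    ... | inj₂ (A , B , eq , inj₁ (pathA , pathB)) =
      let uniqueA , uniqueB , disjoint = unique-++⁻ A (subst Unique eq (Unique.tabulate⁺ injective)) in
      twoPaths (path-reverse (Graph.sym G) pathA) pathB
        (Unique.++⁺ (unique-reverse uniqueA) uniqueB λ (v∈A , v∈B) → disjoint (Any.reverse⁻ v∈A , v∈B))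
        (≤-reflexive (≡-trans (≡-sym (length-tabulate p)) (≡-trans (cong length eq) (≡-trans (length-++ A)
          (cong (_+ length B) (≡-sym (length-reverse A)))))))
    ... | inj₂ (A , B , eq , inj₂ (pathA , pathB)) =
      let uniqueA , uniqueB , disjoint = unique-++⁻ A (subst Unique eq (Unique.tabulate⁺ injective)) in
      twoPaths pathB (path-reverse (Graph.sym G) pathA)
        (Unique.++⁺ uniqueB (unique-reverse uniqueA) λ (v∈B , v∈A) → disjoint (Any.reverse⁻ v∈A , v∈B))
        (≤-reflexive (≡-trans (≡-sym (length-tabulate p)) (≡-trans (cong length eq) (≡-trans (length-++ A)
          (≡-trans (+-comm (length A) _) (cong (length B +_) (≡-sym (length-reverse A))))))))

  module _ (X Y : Subset n) (dX dY : ℕ) (dX≤ : ∀ {v} → v ∈ X → dX ≤ ∣ nbrs G v X ∣) (dY≤ : ∀ {v} → v ∈ Y → dY ≤ ∣ nbrs G v Y ∣)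
           (k≤ : k ≤ suc (dX + dY)) where

    private
      _∈?ₗ_ = memberOf (Fin._≟_ {n})

    -- A common neighbour off the two paths, inserted between reversed `A` and `B`, merges them into
    -- one.
    bridged : ∀ {x y v} (ps : TwoPaths x y) → let open TwoPaths ps in v ∉ₗ xs ++ ys → Adj G x v → Adj G v y → ContainsPath G k
    bridged {v = v} (twoPaths {A} {B} pathA pathB unique k≤) v∉ e e′ = path⇒ContainsPath {G = G}
      (append (path-reverse (Graph.sym G) pathA) e (e′ ◅ pathB))
      (let uniqueA , uniqueB , disjoint = unique-++⁻ A unique in
       Unique.++⁺ (unique-reverse uniqueA) (unique-∷ (v∉ ∘ ∈-++⁺ʳ A) uniqueB) λ
       { (v∈A , here refl) → v∉ (∈-++⁺ˡ {xs = A} (Any.reverse⁻ v∈A))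
       ; (v∈A , there v∈B) → disjoint (Any.reverse⁻ v∈A , v∈B) })
      (begin
        k                                          ≤⟨ k≤ ⟩
        length A + length B                        ≤⟨ +-monoʳ-≤ (length A) (n≤1+n (length B)) ⟩
        length A + suc (length B)                  ≡⟨ cong (_+ suc (length B)) (length-reverse A) ⟨
        length (reverse A) + suc (length B)        ≡⟨ length-++ (reverse A) ⟨
        length (reverse A ++ v ∷ B)                ∎)
      where open ≤-Reasoning

    -- Neighbours of x in X and of y in Y off the two paths either close up a long path or
    -- start a longer pair of paths; the fuel bounds how much longer a pair can still get.
    no-TwoPaths : ∀ fuel {x y} → x ∈ X → y ∈ Y → ¬ Adj G x y → (ps : TwoPaths x y) → let open TwoPaths ps in
                  n < fuel + (length xs + length ys) → ⊥
    no-TwoPaths zero _ _ _ (twoPaths {A} _ _ unique _) n< =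
      <⇒≱ n< (≤-trans (≤-reflexive (≡-sym (length-++ A))) (unique⇒length≤ unique))
    no-TwoPaths (suc fuel) {x} {y} x∈X y∈Y ¬adj ps@(twoPaths {A} {B} pathA pathB unique k≤length) n<
      with any? (λ v → (v ∈? nbrs G x X) ×-dec ¬? (v ∈?ₗ (A ++ B))) | any? (λ v → (v ∈? nbrs G y Y) ×-dec ¬? (v ∈?ₗ (A ++ B)))
    ... | yes (v , v∈N , v∉) | _ with ∈-setOf⁻ (nbr? G x X) v∈N | adj? G v y
    ...   | e , _   | yes e′ = P-free (bridged ps v∉ e e′)
    -- The pair now starts at `v` and `y`. Since `v` lies in `X` as well, the degree condition still
    -- applies.
    ...   | e , v∈X | no ¬e′ = no-TwoPaths fuel v∈X y∈Y ¬e′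
      (twoPaths (Graph.sym G e ◅ pathA) pathB (unique-∷ v∉ unique) (≤-trans k≤length (n≤1+n _)))
      (≤-trans n< (≤-reflexive (≡-sym (+-suc fuel _))))
    no-TwoPaths (suc fuel) {x} {y} x∈X y∈Y ¬adj ps@(twoPaths {A} {B} pathA pathB unique k≤length) n<
        | no _ | yes (v , v∈N , v∉) with ∈-setOf⁻ (nbr? G y Y) v∈N | adj? G x v
    ...   | e , _   | yes e′ = P-free (bridged ps v∉ e′ (Graph.sym G e))
    ...   | e , v∈Y | no ¬e′ = no-TwoPaths fuel x∈X v∈Y ¬e′
      (twoPaths pathA (Graph.sym G e ◅ pathB)
        (let uniqueA , uniqueB , disjoint = unique-++⁻ A unique in
         Unique.++⁺ uniqueA (unique-∷ (v∉ ∘ ∈-++⁺ʳ A) uniqueB) λ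
         { (v∈A , here refl) → v∉ (∈-++⁺ˡ v∈A)
         ; (v∈A , there v∈B) → disjoint (v∈A , v∈B) })
        (≤-trans k≤length (+-monoʳ-≤ (length A) (n≤1+n _))))
      (≤-trans n< (≤-reflexive (≡-trans (≡-sym (+-suc fuel _)) (cong (fuel +_) (≡-sym (+-suc (length A) _))))))
    no-TwoPaths (suc fuel) {x} {y} x∈X y∈Y ¬adj (twoPaths {A} {B} pathA pathB unique k≤length) n< | no NX⊆ | no NY⊆ =
      P-free (Pósa.longPath G connected 1≤k pathA pathB unique (nbrs G x X) (nbrs G y Y)
        (proj₁ ∘ ∈-setOf⁻ (nbr? G x X)) (proj₁ ∘ ∈-setOf⁻ (nbr? G y Y))
        (λ {v} v∈ → decidable-stable (v ∈?ₗ (A ++ B)) λ v∉ → NX⊆ (v , v∈ , v∉))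
        (λ {v} v∈ → decidable-stable (v ∈?ₗ (A ++ B)) λ v∉ → NY⊆ (v , v∈ , v∉))
        (≤-trans k≤ (s≤s (+-mono-≤ (dX≤ x∈X) (dY≤ y∈Y)))) k≤length)

    cores-adjacent : ∀ {x y} → x ∈ X → y ∈ Y → x ≢ y → Adj G x y
    cores-adjacent {x} {y} x∈X y∈Y x≢y = decidable-stable (adj? G x y) λ ¬adj →
      no-TwoPaths (suc n) x∈X y∈Y ¬adj (nonadjacent⇒TwoPaths x≢y ¬adj) (s≤s (m≤m+n n _))

-- Cliques in graphs without long paths

boundary : ∀ {n} {G : Graph n} {K : Subset n} {a b} → Walk G a b → a ∉ K → b ∈ K → ∃₂ λ v u → v ∉ K × u ∈ K × Adj G v u
boundary here a∉K b∈K = contradiction b∈K a∉K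
boundary {G = G} {K = K} (step {v = v} e walk) a∉K b∈K with v ∈? K
... | yes v∈K = _ , v , a∉K , v∈K , e
... | no  v∉K = boundary {G = G} walk v∉K b∈K

clique-path : ∀ {n} {G : Graph n} {K : Subset n} → IsClique G K → ∀ {u} us → Unique (u ∷ us) → (∀ {v} → v ∈ₗ u ∷ us → v ∈ K) →
              ∃ λ w → Path (Adj G) u (u ∷ us) w
clique-path clique []       _                  ⊆K = _ , stop
clique-path {G = G} clique {u} (v ∷ us) ((u≢v ∷ _) ∷ unique) ⊆K =
  let w , path = clique-path {G = G} clique us unique (⊆K ∘ there) in
  w , clique u v (⊆K (here refl)) (⊆K (there (here refl))) u≢v ◅ path

-- The starting vertex is prescribed so that an edge entering the clique can be attached in front of
-- the path.
spanning-clique-path : ∀ {n} {G : Graph n} {K : Subset n} → IsClique G K → ∀ {u} → u ∈ K →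
                       ∃₂ λ us w → Path (Adj G) u us w × Unique us × (∀ {v} → v ∈ₗ us → v ∈ K) × ∣ K ∣ ≤ length us
spanning-clique-path {n} {G} {K} clique {u} u∈K =
  u ∷ others , clique-path {G = G} clique others unique ⊆K .proj₁ , clique-path {G = G} clique others unique ⊆K .proj₂ , unique , ⊆K , (begin
    ∣ K ∣                                    ≡⟨ ∣erase∣ u∈K ⟩
    suc ∣ erase u K ∣                        ≤⟨ s≤s (card-≤-# (erase u K) (allFin n) (λ {v} _ → ∈-allFin v)) ⟩
    suc (# (_∈? erase u K) (allFin n))       ≡⟨ cong suc (#-filter (_∈? erase u K) (allFin n)) ⟨
    suc (length others)                      ∎)
  where
  open ≤-Reasoning
  others = filter (_∈? erase u K) (allFin n)
  others⊆ : ∀ {v} → v ∈ₗ others → v ∈ K × v ≢ u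
  others⊆ v∈ = ∈-erase⁻ (∈-filter⁻ (_∈? erase u K) {xs = allFin n} v∈ .proj₂)
  unique : Unique (u ∷ others)
  unique = unique-∷ (λ u∈ → others⊆ u∈ .proj₂ refl) (Unique.filter⁺ (_∈? erase u K) (Unique.allFin⁺ n))
  ⊆K : ∀ {v} → v ∈ₗ u ∷ others → v ∈ K
  ⊆K (here refl) = u∈K
  ⊆K (there v∈)  = others⊆ v∈ .proj₁

-- If some vertex is outside `K`, connectivity supplies an edge entering `K`, and prefixing it to a
-- spanning path of `K` gives `∣ K ∣ + 1` vertices. If `K` is everything, its spanning path has `n`
-- vertices, at least `k`.
clique-small : ∀ {n} {G : Graph n} {k} → Connected G → 2 ≤ k → k ≤ n → ¬ ContainsPath G k →
               ∀ {K} → IsClique G K → suc ∣ K ∣ < k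
clique-small {n} {G} {k} connected 2≤k k≤n P-free {K} clique = ≰⇒> too-large
  where
  too-large : k ≤ suc ∣ K ∣ → ⊥
  too-large k≤ with nonempty? K | any? (λ v → ¬? (v ∈? K))
  ... | no empty      | _ = <⇒≱ 2≤k (≤-trans k≤ (s≤s (≤-reflexive (≡-trans (cong ∣_∣ (Empty-unique empty)) (∣⊥∣≡0 n)))))
  ... | yes (u , u∈K) | no full =
    let us , w , path , unique , _ , K≤ = spanning-clique-path {G = G} clique u∈K in
    P-free (path⇒ContainsPath {G = G} path unique (≤-trans k≤n (≤-trans (≤-reflexive (≡-sym (∣⊤∣≡n n))) (≤-trans
      (p⊆q⇒∣p∣≤∣q∣ {p = ⊤} (λ {v} _ → decidable-stable (v ∈? K) λ v∉K → full (v , v∉K))) K≤))))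
  ... | yes (u , u∈K) | yes (v , v∉K) with boundary {G = G} (connected v u) v∉K u∈K
  ...   | v′ , u′ , v′∉K , u′∈K , e =
    let us , w , path , unique , us⊆K , K≤ = spanning-clique-path {G = G} clique u′∈K in
    P-free (path⇒ContainsPath {G = G} (e ◅ path) (unique-∷ (v′∉K ∘ us⊆K) unique) (≤-trans k≤ (s≤s K≤)))

cliqueCount-mono : ∀ {n} s {G H : Graph n} → G ⊑ H → cliqueCount s G ≤ cliqueCount s H
cliqueCount-mono {n} s {G} {H} G⊑H = begin
  cliqueCount s G                   ≡⟨ #-filter (ofG) (allSubsets n) ⟩
  # ofG (allSubsets n)              ≤⟨ #-mono ofG ofH (λ (c , clique) → c , λ u v u∈ v∈ u≢v → G⊑H (clique u v u∈ v∈ u≢v)) (allSubsets n) ⟩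
  # ofH (allSubsets n)              ≡⟨ #-filter (ofH) (allSubsets n) ⟨
  cliqueCount s H                   ∎
  where
  open ≤-Reasoning
  ofG = λ S → (∣ S ∣ ≟ s) ×-dec isClique? G S
  ofH = λ S → (∣ S ∣ ≟ s) ×-dec isClique? H S

-- The bound for saturated graphs

module SaturatedBound {n} (G : Graph n) (connected : Connected G) (k₁ : ℕ) (3≤k₁ : 3 ≤ k₁) (k≤n : suc k₁ ≤ n)
                      (P-free : ¬ ContainsPath G (suc k₁)) (saturated : ∀ x y → SaturatedAt (suc k₁) G x y)
                      (j t : ℕ) (t≤k₁ : t ≤ k₁) (k₁≤ : suc k₁ ≤ suc (suc t + suc t)) where

  private
    s = suc j
    bound = f s n k₁ 1 ⊔ f s n k₁ t

  k₁≤n : k₁ ≤ n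
  k₁≤n = <⇒≤ k≤n

  -- All but `k₁ ∸ a` vertices are deleted, that is `(n ∸ k₁) + a` of them, which makes the bound of
  -- `disintegrate` exactly `f s n k₁ a`.
  bound-or-core : ∀ a → a ≤ k₁ → cliqueCount s G ≤ f s n k₁ a ⊎
                  ∃ λ X → k₁ ∸ a < ∣ X ∣ × (∀ {v} → v ∈ X → a < ∣ nbrs G v X ∣)
  bound-or-core a a≤k₁ with disintegrate G j (k₁ ∸ a) a ((n ∸ k₁) + a) ⊤ (≡-trans (∣⊤∣≡n n) n≡)
    where
    open ≡-Reasoning
    n≡ : n ≡ ((n ∸ k₁) + a) + (k₁ ∸ a)
    n≡ = begin
      n                              ≡⟨ m∸n+n≡m k₁≤n ⟨
      (n ∸ k₁) + k₁                  ≡⟨ cong ((n ∸ k₁) +_) (m+[n∸m]≡n a≤k₁) ⟨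
      (n ∸ k₁) + (a + (k₁ ∸ a))      ≡⟨ +-assoc (n ∸ k₁) a (k₁ ∸ a) ⟨
      ((n ∸ k₁) + a) + (k₁ ∸ a)      ∎
  ... | inj₂ core = inj₂ core
  ... | inj₁ le   = inj₁ (begin
    cliqueCount s G          ≡⟨ #-filter ofG (allSubsets n) ⟩
    # ofG (allSubsets n)     ≤⟨ #-mono ofG (cliqueIn? G s ⊤) (λ (c , clique) → (c , λ _ → ∈⊤) , clique) (allSubsets n) ⟩
    cliquesIn G s ⊤          ≤⟨ le ⟩
    f s n k₁ a               ∎)
    where
    open ≤-Reasoning
    ofG = λ S → (∣ S ∣ ≟ s) ×-dec isClique? G S

  -- Convexity is applied to the sequence shifted by one, so that its first value is the one at 1.
  f≤bound : ∀ a → 1 ≤ a → a ≤ t → f s n k₁ a ≤ bound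
  f≤bound (suc i) _ 1+i≤t = subst (λ b → f s n k₁ (suc i) ≤ f s n k₁ 1 ⊔ f s n k₁ b) (m+[n∸m]≡n 1+i≤t)
    (convex-≤-⊔ {f s n k₁ ∘ suc} (λ a → f-convex s n k₁ (suc a)) i (t ∸ suc i))

  -- The core for minimum degree k - |K| has a vertex outside the clique K, and saturation makes
  -- that vertex adjacent to all of K.
  clique⇒bound : ∀ fuel K → IsClique G K → k₁ ≤ ∣ K ∣ + t → k₁ ≤ fuel + ∣ K ∣ → 1 ≤ ∣ K ∣ → cliqueCount s G ≤ bound
  clique⇒bound fuel K clique large enough 1≤K
    with clique-small {G = G} connected (≤-trans (s≤s (s≤s z≤n)) (s≤s 3≤k₁)) k≤n P-free clique
       | bound-or-core (k₁ ∸ ∣ K ∣) (m∸n≤m k₁ ∣ K ∣)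
  -- The parameter lies between 1 and `t`: it is positive because `∣ K ∣ < k₁`, and `large` bounds
  -- it by `t`.
  ... | s≤s K<k₁ | inj₁ le = ≤-trans le (f≤bound (k₁ ∸ ∣ K ∣) (m<n⇒0<n∸m K<k₁) (m≤n+o⇒m∸n≤o k₁ ∣ K ∣ large))
  ... | s≤s K<k₁ | inj₂ (X , X> , degrees) with fuel | any? (λ v → (v ∈? X) ×-dec ¬? (v ∈? K))
  ...   | zero   | _ = contradiction enough (<⇒≱ K<k₁)
  -- A core inside `K` would be too small: it has more than `k₁ ∸ (k₁ ∸ ∣ K ∣) = ∣ K ∣` vertices.
  ...   | _      | no X⊆K = contradiction
    (p⊆q⇒∣p∣≤∣q∣ λ {v} v∈X → decidable-stable (v ∈? K) λ v∉K → X⊆K (v , v∈X , v∉K))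
    (<⇒≱ (subst (_< ∣ X ∣) (m∸[m∸n]≡n (<⇒≤ K<k₁)) X>))
  ...   | suc fuel′ | yes (v , v∈X , v∉K) = clique⇒bound fuel′ K⁺ clique⁺
      (≤-trans large (+-monoˡ-≤ t (<⇒≤ K<K⁺)))
      (≤-trans enough (≤-trans (≤-reflexive (≡-sym (+-suc fuel′ ∣ K ∣))) (+-monoʳ-≤ fuel′ K<K⁺)))
      (≤-trans 1≤K (<⇒≤ K<K⁺))
    where
    K⁺ = K ∪ ⁅ v ⁆
    K<K⁺ : ∣ K ∣ < ∣ K⁺ ∣
    K<K⁺ = p⊂q⇒∣p∣<∣q∣ (p⊆p∪q ⁅ v ⁆ , v , x∈p∪q⁺ (inj₂ (x∈⁅x⁆ v)) , v∉K)
    clique-degree : ∀ {u} → u ∈ K → ∣ K ∣ ∸ 1 ≤ ∣ nbrs G u K ∣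
    clique-degree {u} u∈K = subst (λ m → m ∸ 1 ≤ ∣ nbrs G u K ∣) (≡-sym (∣erase∣ u∈K)) (p⊆q⇒∣p∣≤∣q∣ λ w∈ →
      let w∈K , w≢u = ∈-erase⁻ w∈ in ∈-setOf⁺ (nbr? G u K) (clique u _ u∈K w∈K (w≢u ∘ ≡-sym) , w∈K))
    -- Minimum degrees `∣ K ∣ ∸ 1` in `K` and `k₁ ∸ ∣ K ∣ + 1` in `X` add up to exactly `k₁`.
    degree-sum : suc k₁ ≤ suc ((∣ K ∣ ∸ 1) + suc (k₁ ∸ ∣ K ∣))
    degree-sum = s≤s (≤-reflexive (begin
      k₁                                    ≡⟨ m+[n∸m]≡n (<⇒≤ K<k₁) ⟨
      ∣ K ∣ + (k₁ ∸ ∣ K ∣)                  ≡⟨ cong (_+ (k₁ ∸ ∣ K ∣)) (m+[n∸m]≡n 1≤K) ⟨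
      suc ((∣ K ∣ ∸ 1) + (k₁ ∸ ∣ K ∣))      ≡⟨ +-suc (∣ K ∣ ∸ 1) _ ⟨
      (∣ K ∣ ∸ 1) + suc (k₁ ∸ ∣ K ∣)        ∎))
      where open ≡-Reasoning
    joined : ∀ {u} → u ∈ K → Adj G u v
    joined u∈K = Saturated.cores-adjacent G connected (s≤s z≤n) P-free saturated K X _ _ clique-degree degrees degree-sum
      u∈K v∈X λ { refl → v∉K u∈K }
    clique⁺ : IsClique G K⁺
    clique⁺ u w u∈ w∈ u≢w with x∈p∪q⁻ K ⁅ v ⁆ u∈ | x∈p∪q⁻ K ⁅ v ⁆ w∈
    ... | inj₁ u∈K | inj₁ w∈K = clique u w u∈K w∈K u≢w
    ... | inj₁ u∈K | inj₂ w∈v with refl ← x∈⁅y⁆⇒x≡y v w∈v = joined u∈K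
    ... | inj₂ u∈v | inj₁ w∈K with refl ← x∈⁅y⁆⇒x≡y v u∈v = Graph.sym G (joined w∈K)
    ... | inj₂ u∈v | inj₂ w∈v = contradiction (≡-trans (x∈⁅y⁆⇒x≡y v u∈v) (≡-sym (x∈⁅y⁆⇒x≡y v w∈v))) u≢w

  -- The core for `t` is joined to itself, since two minimum degrees of `t + 1` sum to at least
  -- `k₁`; so it is a clique, and having more than `k₁ ∸ t` vertices it meets the size condition of
  -- `clique⇒bound`.
  cliqueCount≤bound : cliqueCount s G ≤ bound
  cliqueCount≤bound with bound-or-core t t≤k₁
  ... | inj₁ le = ≤-trans le (m≤n⊔m (f s n k₁ 1) _)
  ... | inj₂ (X , X> , degrees) = clique⇒bound k₁ X
    (λ u v u∈ v∈ → Saturated.cores-adjacent G connected (s≤s z≤n) P-free saturated X X _ _ degrees degrees k₁≤ u∈ v∈)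
    (≤-trans (m≤n+m∸n k₁ t) (≤-trans (+-monoʳ-≤ t (<⇒≤ X>)) (≤-reflexive (+-comm t ∣ X ∣))))
    (m≤m+n k₁ ∣ X ∣)
    (≤-trans (s≤s z≤n) X>)

-- Reduction to saturated graphs

walk-mono : ∀ {n} {G H : Graph n} → G ⊑ H → ∀ {u v} → Walk G u v → Walk H u v
walk-mono G⊑H here          = here
walk-mono {H = H} G⊑H (step e walk) = step (G⊑H e) (walk-mono {H = H} G⊑H walk)

theorem1p6 : (s n k : ℕ) → 2 ≤ s → 4 ≤ k → k ≤ n →
    (G : Graph n) → Connected G → ¬ ContainsPath G k →
    cliqueCount s G ≤ (f s n (k ∸ 1) 1 ⊔ f s n (k ∸ 1) ((k ∸ 2) / 2))
theorem1p6 (suc _) _ (suc zero) _ (s≤s ())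
-- The inequality is decidable and hence stable under double negation, which lets the proof pass to
-- a saturated supergraph.
theorem1p6 (suc j) n (suc (suc k₂)) _ 4≤k k≤n G connected P-free = decidable-stable (_ ≤? _) λ exceeds →
  ¬¬saturate (suc (suc k₂)) (cartesianProduct (allFin n) (allFin n)) G P-free λ H G⊑H H-free saturated → exceeds (≤-trans
    (cliqueCount-mono (suc j) {G} {H} G⊑H)
    (SaturatedBound.cliqueCount≤bound H (λ u v → walk-mono {H = H} G⊑H (connected u v)) (suc k₂) (≤-pred 4≤k) k≤n H-free
      (λ x y → saturated (∈-cartesianProduct⁺ (∈-allFin x) (∈-allFin y)))
      j (k₂ / 2) (≤-trans (m/n≤m k₂ 2) (n≤1+n k₂)) degree-sum))
  where
  open ≤-Reasoning
  rearrange : ∀ t → 3 + t * 2 ≡ suc (suc t + suc t)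
  rearrange = solve-∀
  -- For `t = k₂ / 2` this reads `k - 1 ≤ 2(t + 1)`: halving loses at most the remainder 1.
  degree-sum : suc (suc k₂) ≤ suc (suc (k₂ / 2) + suc (k₂ / 2))
  degree-sum = begin
    2 + k₂                             ≡⟨ cong (2 +_) (m≡m%n+[m/n]*n k₂ 2) ⟩
    2 + (k₂ % 2 + k₂ / 2 * 2)          ≤⟨ +-monoʳ-≤ 2 (+-monoˡ-≤ (k₂ / 2 * 2) (≤-pred (m%n<n k₂ 2))) ⟩
    3 + k₂ / 2 * 2                     ≡⟨ rearrange (k₂ / 2) ⟩
    suc (suc (k₂ / 2) + suc (k₂ / 2))  ∎
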